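{- Let $G$ be a finite simple connected edge transitive graph. If $\lambda$ is an eigenvalue of the normalized Laplacian $\mathcal{L}$ of $G$, then $\dfrac{d\lambda}{de}=0$ for every edge $e$ of $G$.
   Context: A graph is edge transitive if for every pair of edges $e_1,e_2$ there is a graph automorphism mapping $e_1$ to $e_2$. For a finite simple connected graph $G$ with at least two vertices, $A$ is the adjacency matrix, $d_x$ is the degree of the vertex $x$, $D$ is the diagonal matrix of degrees (invertible), and the normalized Laplacian is $\mathcal{L} = I - D^{ -1/2} A D^{ -1/2}$. Edge derivative: let $\lambda$ be an eigenvalue of $\mathcal{L}$ of multiplicity $k$, let $\mathbf{v}_1,\dots,\mathbf{v}_k$ be an orthonormal basis of the $\lambda$-eigenspace, and write $\mathbf{v}_{i,x}$ for the entry of $\mathbf{v}_i$ at the vertex $x$. For a pair $e=\{x,y\}$ of distinct vertices (adjacent or not), $$\frac{d\lambda}{de}=\frac{d\lambda}{d\{x,y\}} = \frac1k\sum_{i=1}^k\left[(1-\lambda)\left(\frac{\mathbf{v}_{i,x}^2}{d_x}+\frac{\mathbf{v}_{i,y}^2}{d_y}\right)-2\,\frac{\mathbf{v}_{i,x}\mathbf{v}_{i,y}}{\sqrt{d_xd_y}}\right].$$ This value does not depend on the choice of the orthonormal basis. (It is the average over $i$ of $\mathbf{v}_i^T \mathcal{L}'(0)\mathbf{v}_i$, where $\mathcal{L}(t)$ is the normalized Laplacian of the weighted graph obtained from $G$ by adding $t$ to the weight of the pair $\{x,y\}$, edges having weight 1 and non-edges weight 0.) -}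

module Defs where

open import Algebra.Bundles using (CommutativeRing)
open import Algebra.Structures using (IsCommutativeRing)
open import Data.Bool.Base using (if_then_else_)
open import Data.Fin.Base using (Fin; zero; suc)
import Data.Fin.Properties as Fin
open import Data.Fin.Permutation using (Permutation′; _⟨$⟩ʳ_)
import Data.Integer.Base as ℤ
import Data.Integer.Properties as ℤ
open import Data.List.Base using (length; filter; allFin)
open import Data.List.Membership.Propositional using (_∈_)
open import Data.List.Membership.Propositional.Properties using (∈-filter⁺; ∈-allFin)
open import Data.List.Relation.Unary.Any using (here; there)
open import Data.Nat.Base as ℕ using (ℕ; zero; suc; z≤n; s≤s)
import Data.Nat.Properties as ℕ
open import Data.Nat.Solver using (module +-*-Solver)
open import Data.Product.Base using (Σ; ∃; _×_; _,_; proj₂)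
open import Data.Rational.Base as ℚ using (ℚ; 0ℚ; 1ℚ; ½; mkℚ; fromℚᵘ)
import Data.Rational.Properties as ℚ
import Data.Rational.Solver as ℚSolver
open import Data.Rational.Unnormalised.Base as ℚᵘ using (mkℚᵘ)
import Data.Rational.Unnormalised.Properties as ℚᵘ
open import Data.Sum.Base using (_⊎_; inj₁; inj₂)
open import Data.Vec.Functional using (Vector)
open import Function.Bundles using (_⇔_)
open import Level using (0ℓ)
open import Relation.Binary.Core using (Rel)
open import Relation.Binary.Definitions using (Decidable; Irreflexive; Symmetric)
open import Relation.Binary.Structures using (IsEquivalence)
open import Relation.Binary.Construct.Closure.ReflexiveTransitive using (Star; ε; _◅_)
open import Relation.Binary.PropositionalEquality
  using (_≡_; _≢_; refl; sym; trans; cong; cong₂; subst; subst₂)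
open import Relation.Nullary using (¬_; yes; no; does; contradiction)

-- Real numbers are Cauchy sequences of rationals up to equivalence.
-- Two sequences are equivalent when x m - y n tends to 0 as m and n
-- tend to infinity independently.  In particular x ~ x says that x is a
-- Cauchy sequence, and on Cauchy sequences x ~ y says that they have
-- the same limit.

infix 4 _~_

_~_ : Rel (ℕ → ℚ) 0ℓ
x ~ y = ∀ (δ : ℚ) → 0ℚ ℚ.< δ →
        ∃ λ (N : ℕ) → ∀ m n → N ℕ.≤ m → N ℕ.≤ n → ℚ.∣ x m ℚ.- y n ∣ ℚ.≤ δ

-- Without eta, the arithmetic operations below do not unfold during
-- unification.
record ℝ : Set where
  no-eta-equality
  field
    seq    : ℕ → ℚ
    cauchy : seq ~ seq

open ℝ public

infix 4 _≈_

-- A record rather than a synonym, so that a and b can be inferred.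
record _≈_ (a b : ℝ) : Set where
  constructor mk≈
  field
    equiv : seq a ~ seq b

open _≈_ public

module Sequences where

  ∣-∣-swap : ∀ p q → ℚ.∣ p ℚ.- q ∣ ≡ ℚ.∣ q ℚ.- p ∣
  ∣-∣-swap p q = trans (sym (ℚ.∣-p∣≡∣p∣ (p ℚ.- q))) (cong ℚ.∣_∣ eq)
    where
    open ℚSolver.+-*-Solver
    eq : ℚ.- (p ℚ.- q) ≡ q ℚ.- p
    eq = solve 2 (λ p q → :- (p :- q) := q :- p) refl p q

  telescope : ∀ p q r → (p ℚ.- q) ℚ.+ (q ℚ.- r) ≡ p ℚ.- r
  telescope = solve 3 (λ p q r → (p :- q) :+ (q :- r) := p :- r) refl
    where open ℚSolver.+-*-Solver

  ∣-∣-triangle : ∀ p q r → ℚ.∣ p ℚ.- r ∣ ℚ.≤ ℚ.∣ p ℚ.- q ∣ ℚ.+ ℚ.∣ q ℚ.- r ∣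
  ∣-∣-triangle p q r =
    subst (λ t → ℚ.∣ t ∣ ℚ.≤ ℚ.∣ p ℚ.- q ∣ ℚ.+ ℚ.∣ q ℚ.- r ∣) (telescope p q r) (ℚ.∣p+q∣≤∣p∣+∣q∣ (p ℚ.- q) (q ℚ.- r))

  ∣p∣≤-intro : ∀ p {δ} → p ℚ.≤ δ → ℚ.- p ℚ.≤ δ → ℚ.∣ p ∣ ℚ.≤ δ
  ∣p∣≤-intro p p≤δ -p≤δ with ℚ.∣p∣≡p∨∣p∣≡-p p
  ... | inj₁ e = subst (ℚ._≤ _) (sym e) p≤δ
  ... | inj₂ e = subst (ℚ._≤ _) (sym e) -p≤δ

  half>0 : ∀ {δ} → 0ℚ ℚ.< δ → 0ℚ ℚ.< ½ ℚ.* δ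
  half>0 {δ} δ>0 = subst (ℚ._< ½ ℚ.* δ) (ℚ.*-zeroʳ ½) (ℚ.*-monoʳ-<-pos ½ δ>0)

  halves : ∀ δ → ½ ℚ.* δ ℚ.+ ½ ℚ.* δ ≡ δ
  halves δ = trans (sym (ℚ.*-distribʳ-+ δ ½ ½)) (ℚ.*-identityˡ δ)

  ~-sym : ∀ {x y} → x ~ y → y ~ x
  ~-sym {x} {y} p δ δ>0 with p δ δ>0
  ... | N , f = N , λ m n N≤m N≤n →
    subst (ℚ._≤ δ) (∣-∣-swap (x n) (y m)) (f n m N≤n N≤m)

  ~-trans : ∀ {x y z} → x ~ y → y ~ z → x ~ z
  ~-trans {x} {y} {z} p q δ δ>0 with p (½ ℚ.* δ) (half>0 δ>0) | q (½ ℚ.* δ) (half>0 δ>0)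
  ... | N₁ , f | N₂ , g = N , λ m n N≤m N≤n → ℚ.≤-trans
    (∣-∣-triangle (x m) (y N) (z n))
    (subst (ℚ.∣ x m ℚ.- y N ∣ ℚ.+ ℚ.∣ y N ℚ.- z n ∣ ℚ.≤_) (halves δ)
      (ℚ.+-mono-≤ (f m N (ℕ.≤-trans N₁≤N N≤m) N₁≤N) (g N n N₂≤N (ℕ.≤-trans N₂≤N N≤n))))
    where
    N = N₁ ℕ.⊔ N₂
    N₁≤N = ℕ.m≤m⊔n N₁ N₂
    N₂≤N = ℕ.m≤n⊔m N₁ N₂

  ~-resp : ∀ {x y x′ y′} → (∀ n → x n ≡ x′ n) → (∀ n → y n ≡ y′ n) → x ~ y → x′ ~ y′
  ~-resp e₁ e₂ p δ δ>0 with p δ δ>0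
  ... | N , f = N , λ m n N≤m N≤n →
    subst₂ (λ a b → ℚ.∣ a ℚ.- b ∣ ℚ.≤ δ) (e₁ m) (e₂ n) (f m n N≤m N≤n)

  const-~ : ∀ q → (λ _ → q) ~ (λ _ → q)
  const-~ q δ δ>0 = 0 , λ _ _ _ _ → subst (λ t → ℚ.∣ t ∣ ℚ.≤ δ) (sym (ℚ.+-inverseʳ q)) (ℚ.<⇒≤ δ>0)

  +-~ : ∀ {x x′ y y′} → x ~ x′ → y ~ y′ → (λ n → x n ℚ.+ y n) ~ (λ n → x′ n ℚ.+ y′ n)
  +-~ {x} {x′} {y} {y′} p q δ δ>0 with p (½ ℚ.* δ) (half>0 δ>0) | q (½ ℚ.* δ) (half>0 δ>0)
  ... | N₁ , f | N₂ , g = N₁ ℕ.⊔ N₂ , λ m n N≤m N≤n →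
    subst₂ ℚ._≤_ (cong ℚ.∣_∣ (eq (x m) (x′ n) (y m) (y′ n))) (halves δ) (ℚ.≤-trans
      (ℚ.∣p+q∣≤∣p∣+∣q∣ (x m ℚ.- x′ n) (y m ℚ.- y′ n))
      (ℚ.+-mono-≤ (f m n (ℕ.m⊔n≤o⇒m≤o N₁ N₂ N≤m) (ℕ.m⊔n≤o⇒m≤o N₁ N₂ N≤n))
                  (g m n (ℕ.m⊔n≤o⇒n≤o N₁ N₂ N≤m) (ℕ.m⊔n≤o⇒n≤o N₁ N₂ N≤n))))
    where
    open ℚSolver.+-*-Solver
    eq : ∀ a b c d → (a ℚ.- b) ℚ.+ (c ℚ.- d) ≡ (a ℚ.+ c) ℚ.- (b ℚ.+ d)
    eq = solve 4 (λ a b c d → (a :- b) :+ (c :- d) := (a :+ c) :- (b :+ d)) refl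

  neg-~ : ∀ {x x′} → x ~ x′ → (λ n → ℚ.- x n) ~ (λ n → ℚ.- x′ n)
  neg-~ {x} {x′} p δ δ>0 with p δ δ>0
  ... | N , f = N , λ m n N≤m N≤n →
    subst (ℚ._≤ δ) (trans (∣-∣-swap (x m) (x′ n)) (cong ℚ.∣_∣ (eq (x m) (x′ n)))) (f m n N≤m N≤n)
    where
    open ℚSolver.+-*-Solver
    eq : ∀ a b → b ℚ.- a ≡ (ℚ.- a) ℚ.- (ℚ.- b)
    eq = solve 2 (λ a b → b :- a := (:- a) :- (:- b)) refl

  bounded : ∀ {x} → x ~ x →
            ∃ λ (B : ℚ) → ℚ.Positive B × ∃ λ (N : ℕ) → ∀ n → N ℕ.≤ n → ℚ.∣ x n ∣ ℚ.≤ B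
  bounded {x} p with p 1ℚ (ℚ.positive⁻¹ 1ℚ)
  ... | N , f = 1ℚ ℚ.+ ℚ.∣ x N ∣ , ℚ.positive B>0 , N , λ n N≤n →
    ℚ.≤-trans (subst (λ t → ℚ.∣ t ∣ ℚ.≤ ℚ.∣ x n ℚ.- x N ∣ ℚ.+ ℚ.∣ x N ∣) (eq (x n) (x N)) (ℚ.∣p+q∣≤∣p∣+∣q∣ (x n ℚ.- x N) (x N)))
              (ℚ.+-monoˡ-≤ ℚ.∣ x N ∣ (f n N N≤n ℕ.≤-refl))
    where
    open ℚSolver.+-*-Solver
    eq : ∀ a b → (a ℚ.- b) ℚ.+ b ≡ a
    eq = solve 2 (λ a b → (a :- b) :+ b := a) refl
    B>0 : 0ℚ ℚ.< 1ℚ ℚ.+ ℚ.∣ x N ∣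
    B>0 = ℚ.+-mono-<-≤ (ℚ.positive⁻¹ 1ℚ) (ℚ.0≤∣p∣ (x N))

  divide : ∀ B → ℚ.Positive B → ∀ {δ} → 0ℚ ℚ.< δ → ∃ λ (η : ℚ) → 0ℚ ℚ.< η × B ℚ.* η ≡ δ
  divide B B>0 {δ} δ>0 = 1/B ℚ.* δ , η>0 , eq
    where
    instance _ = B>0
    instance _ = ℚ.pos⇒nonZero B
    1/B = ℚ.1/ B
    instance _ = ℚ.1/pos⇒pos B
    η>0 = subst (ℚ._< 1/B ℚ.* δ) (ℚ.*-zeroʳ 1/B) (ℚ.*-monoʳ-<-pos 1/B δ>0)
    eq = trans (sym (ℚ.*-assoc B 1/B δ))
               (trans (cong (ℚ._* δ) (ℚ.*-inverseʳ B)) (ℚ.*-identityˡ δ))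

  *-≤ : ∀ a b {B η} → ℚ.Positive B → ℚ.∣ a ∣ ℚ.≤ B → ℚ.∣ b ∣ ℚ.≤ η → ℚ.∣ a ℚ.* b ∣ ℚ.≤ B ℚ.* η
  *-≤ a b {B} {η} B>0 a≤B b≤η = subst (ℚ._≤ B ℚ.* η) (sym (ℚ.∣p*q∣≡∣p∣*∣q∣ a b)) (ℚ.≤-trans
    (ℚ.*-monoʳ-≤-nonNeg ℚ.∣ b ∣ {{ℚ.∣-∣-nonNeg b}} a≤B)
    (ℚ.*-monoˡ-≤-nonNeg B {{ℚ.pos⇒nonNeg B {{B>0}}}} b≤η))

  *-distribˡ-- : ∀ a b c → a ℚ.* (b ℚ.- c) ≡ a ℚ.* b ℚ.- a ℚ.* c
  *-distribˡ-- a b c =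
    trans (ℚ.*-distribˡ-+ a b (ℚ.- c)) (cong (a ℚ.* b ℚ.+_) (sym (ℚ.neg-distribʳ-* a c)))

  *-difference : ∀ a b c d → a ℚ.* (c ℚ.- d) ℚ.+ d ℚ.* (a ℚ.- b) ≡ a ℚ.* c ℚ.- b ℚ.* d
  *-difference a b c d = trans
    (cong₂ ℚ._+_ (*-distribˡ-- a c d) (trans (*-distribˡ-- d a b)
      (cong₂ ℚ._-_ (ℚ.*-comm d a) (ℚ.*-comm d b))))
    (telescope (a ℚ.* c) (a ℚ.* d) (b ℚ.* d))

  ∣*-*∣-≤ : ∀ a b c d {B C β γ} → ℚ.Positive B → ℚ.Positive C →
            ℚ.∣ a ∣ ℚ.≤ B → ℚ.∣ d ∣ ℚ.≤ C → ℚ.∣ c ℚ.- d ∣ ℚ.≤ β → ℚ.∣ a ℚ.- b ∣ ℚ.≤ γ →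
            ℚ.∣ a ℚ.* c ℚ.- b ℚ.* d ∣ ℚ.≤ B ℚ.* β ℚ.+ C ℚ.* γ
  ∣*-*∣-≤ a b c d {B} {C} {β} {γ} B>0 C>0 a≤B d≤C cd≤β ab≤γ =
    subst (λ t → ℚ.∣ t ∣ ℚ.≤ B ℚ.* β ℚ.+ C ℚ.* γ) (*-difference a b c d) (ℚ.≤-trans
      (ℚ.∣p+q∣≤∣p∣+∣q∣ (a ℚ.* (c ℚ.- d)) (d ℚ.* (a ℚ.- b)))
      (ℚ.+-mono-≤ (*-≤ a (c ℚ.- d) B>0 a≤B cd≤β) (*-≤ d (a ℚ.- b) C>0 d≤C ab≤γ)))

  *-~ : ∀ {x x′ y y′} → x ~ x′ → y ~ y′ → (λ n → x n ℚ.* y n) ~ (λ n → x′ n ℚ.* y′ n)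
  *-~ {x} {x′} {y} {y′} p q δ δ>0 =
    let B , B>0 , N₁ , f = bounded {x} (~-trans {x} {x′} {x} p (~-sym {x} {x′} p))
        C , C>0 , N₂ , g = bounded {y′} (~-trans {y′} {y} {y′} (~-sym {y} {y′} q) q)
        β , β>0 , Bβ = divide B B>0 (half>0 δ>0)
        γ , γ>0 , Cγ = divide C C>0 (half>0 δ>0)
        N₃ , h = q β β>0
        N₄ , k = p γ γ>0
        N₁₂ = N₁ ℕ.⊔ N₂
        N₃₄ = N₃ ℕ.⊔ N₄
        ₁≤ = ℕ.≤-trans (ℕ.m≤m⊔n N₁ N₂) (ℕ.m≤m⊔n N₁₂ N₃₄)
        ₂≤ = ℕ.≤-trans (ℕ.m≤n⊔m N₁ N₂) (ℕ.m≤m⊔n N₁₂ N₃₄)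
        ₃≤ = ℕ.≤-trans (ℕ.m≤m⊔n N₃ N₄) (ℕ.m≤n⊔m N₁₂ N₃₄)
        ₄≤ = ℕ.≤-trans (ℕ.m≤n⊔m N₃ N₄) (ℕ.m≤n⊔m N₁₂ N₃₄)
    in N₁₂ ℕ.⊔ N₃₄ , λ m n N≤m N≤n →
      subst (ℚ.∣ x m ℚ.* y m ℚ.- x′ n ℚ.* y′ n ∣ ℚ.≤_)
        (trans (cong₂ ℚ._+_ Bβ Cγ) (halves δ))
        (∣*-*∣-≤ (x m) (x′ n) (y m) (y′ n) B>0 C>0
          (f m (ℕ.≤-trans ₁≤ N≤m)) (g n (ℕ.≤-trans ₂≤ N≤n))
          (h m n (ℕ.≤-trans ₃≤ N≤m) (ℕ.≤-trans ₃≤ N≤n)) (k m n (ℕ.≤-trans ₄≤ N≤m) (ℕ.≤-trans ₄≤ N≤n)))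

open Sequences

infixl 6 _+_
infixl 7 _*_
infix  8 -_

_+_ : ℝ → ℝ → ℝ
(a + b) .seq n  = seq a n ℚ.+ seq b n
(a + b) .cauchy = +-~ {seq a} {seq a} {seq b} {seq b} (cauchy a) (cauchy b)

_*_ : ℝ → ℝ → ℝ
(a * b) .seq n  = seq a n ℚ.* seq b n
(a * b) .cauchy = *-~ {seq a} {seq a} {seq b} {seq b} (cauchy a) (cauchy b)

-_ : ℝ → ℝ
(- a) .seq n  = ℚ.- seq a n
(- a) .cauchy = neg-~ {seq a} {seq a} (cauchy a)

fromℚ : ℚ → ℝ
fromℚ q .seq _  = q
fromℚ q .cauchy = const-~ q

0ℝ 1ℝ : ℝ
0ℝ = fromℚ 0ℚ
1ℝ = fromℚ 1ℚ

fromℕ : ℕ → ℝ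
fromℕ n = fromℚ (ℤ.+ n ℚ./ 1)

1/ℕ : (n : ℕ) → .{{ℕ.NonZero n}} → ℝ
1/ℕ n = fromℚ (ℤ.+ 1 ℚ./ n)

module ℝ-Properties where
  pointwise : ∀ a b → (∀ n → seq a n ≡ seq b n) → a ≈ b
  pointwise a b e = mk≈ (~-resp {seq a} {seq a} {seq a} {seq b} (λ _ → refl) e (cauchy a))

  +-cong : ∀ {a b c d} → a ≈ b → c ≈ d → a + c ≈ b + d
  +-cong {a} {b} {c} {d} (mk≈ p) (mk≈ q) = mk≈ (+-~ {seq a} {seq b} {seq c} {seq d} p q)

  *-cong : ∀ {a b c d} → a ≈ b → c ≈ d → a * c ≈ b * d
  *-cong {a} {b} {c} {d} (mk≈ p) (mk≈ q) = mk≈ (*-~ {seq a} {seq b} {seq c} {seq d} p q)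

  neg-cong : ∀ {a b} → a ≈ b → - a ≈ - b
  neg-cong {a} {b} (mk≈ p) = mk≈ (neg-~ {seq a} {seq b} p)

open ℝ-Properties

≈-isEquivalence : IsEquivalence _≈_
≈-isEquivalence = record
  { refl  = λ {a} → mk≈ (cauchy a)
  ; sym   = λ {a} {b} p → mk≈ (~-sym {seq a} {seq b} (equiv p))
  ; trans = λ {a} {b} {c} p q → mk≈ (~-trans {seq a} {seq b} {seq c} (equiv p) (equiv q))
  }

ℝ-isCommutativeRing : IsCommutativeRing _≈_ _+_ _*_ -_ 0ℝ 1ℝ
ℝ-isCommutativeRing = record
  { isRing = record
    { +-isAbelianGroup = record
      { isGroup = record
        { isMonoid = record
          { isSemigroup = record
            { isMagma = record
              { isEquivalence = ≈-isEquivalence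
              ; ∙-cong = +-cong
              }
            ; assoc = λ a b c → pointwise ((a + b) + c) (a + (b + c)) λ n → ℚ.+-assoc (seq a n) (seq b n) (seq c n)
            }
          ; identity = (λ a → pointwise (0ℝ + a) a λ n → ℚ.+-identityˡ (seq a n))
                     , (λ a → pointwise (a + 0ℝ) a λ n → ℚ.+-identityʳ (seq a n))
          }
        ; inverse = (λ a → pointwise (- a + a) 0ℝ λ n → ℚ.+-inverseˡ (seq a n))
                  , (λ a → pointwise (a + - a) 0ℝ λ n → ℚ.+-inverseʳ (seq a n))
        ; ⁻¹-cong = neg-cong
        }
      ; comm = λ a b → pointwise (a + b) (b + a) λ n → ℚ.+-comm (seq a n) (seq b n)
      }
    ; *-cong = *-cong
    ; *-assoc = λ a b c → pointwise ((a * b) * c) (a * (b * c)) λ n → ℚ.*-assoc (seq a n) (seq b n) (seq c n)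
    ; *-identity = (λ a → pointwise (1ℝ * a) a λ n → ℚ.*-identityˡ (seq a n))
                 , (λ a → pointwise (a * 1ℝ) a λ n → ℚ.*-identityʳ (seq a n))
    ; distrib = (λ a b c → pointwise (a * (b + c)) (a * b + a * c) λ n → ℚ.*-distribˡ-+ (seq a n) (seq b n) (seq c n))
              , (λ a b c → pointwise ((b + c) * a) (b * a + c * a) λ n → ℚ.*-distribʳ-+ (seq a n) (seq b n) (seq c n))
    }
  ; *-comm = λ a b → pointwise (a * b) (b * a) λ n → ℚ.*-comm (seq a n) (seq b n)
  }

ℝ-commutativeRing : CommutativeRing 0ℓ 0ℓ
ℝ-commutativeRing = record { isCommutativeRing = ℝ-isCommutativeRing }

-- ⌊√ n⌋
isqrt : ℕ → ℕ
isqrt zero    = zero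
isqrt (suc n) with suc (isqrt n) ℕ.* suc (isqrt n) ℕ.≤? suc n
... | yes _ = suc (isqrt n)
... | no  _ = isqrt n

isqrt-lower : ∀ n → isqrt n ℕ.* isqrt n ℕ.≤ n
isqrt-lower zero = z≤n
isqrt-lower (suc n) with suc (isqrt n) ℕ.* suc (isqrt n) ℕ.≤? suc n
... | yes p = p
... | no  _ = ℕ.m≤n⇒m≤1+n (isqrt-lower n)

isqrt-upper : ∀ n → n ℕ.< suc (isqrt n) ℕ.* suc (isqrt n)
isqrt-upper zero = s≤s z≤n
isqrt-upper (suc n) with suc (isqrt n) ℕ.* suc (isqrt n) ℕ.≤? suc n
... | yes _ = ℕ.≤-trans (s≤s (isqrt-upper n))
                (ℕ.*-mono-< (ℕ.n<1+n (suc (isqrt n))) (ℕ.n<1+n (suc (isqrt n))))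
... | no ¬p = ℕ.≰⇒> ¬p

√-seq : ℕ → ℕ → ℚ
√-seq d n = ℤ.+ isqrt (d ℕ.* (suc n ℕ.* suc n)) ℚ./ suc n

module √-Properties where

  fromℚᵘ-mono-≤ : ∀ {p q} → p ℚᵘ.≤ q → fromℚᵘ p ℚ.≤ fromℚᵘ q
  fromℚᵘ-mono-≤ {p} {q} p≤q = ℚ.toℚᵘ-cancel-≤
    (ℚᵘ.≤-respˡ-≃ (ℚᵘ.≃-sym (ℚ.toℚᵘ-fromℚᵘ p)) (ℚᵘ.≤-respʳ-≃ (ℚᵘ.≃-sym (ℚ.toℚᵘ-fromℚᵘ q)) p≤q))

  fromℚᵘ-homo-+ : ∀ p q → fromℚᵘ p ℚ.+ fromℚᵘ q ≡ fromℚᵘ (p ℚᵘ.+ q)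
  fromℚᵘ-homo-+ p q = ℚ.toℚᵘ-injective (ℚᵘ.≃-trans (ℚ.toℚᵘ-homo-+ (fromℚᵘ p) (fromℚᵘ q))
    (ℚᵘ.≃-trans (ℚᵘ.+-cong (ℚ.toℚᵘ-fromℚᵘ p) (ℚ.toℚᵘ-fromℚᵘ q)) (ℚᵘ.≃-sym (ℚ.toℚᵘ-fromℚᵘ (p ℚᵘ.+ q)))))

  fromℚᵘ-homo-* : ∀ p q → fromℚᵘ p ℚ.* fromℚᵘ q ≡ fromℚᵘ (p ℚᵘ.* q)
  fromℚᵘ-homo-* p q = ℚ.toℚᵘ-injective (ℚᵘ.≃-trans (ℚ.toℚᵘ-homo-* (fromℚᵘ p) (fromℚᵘ q))
    (ℚᵘ.≃-trans (ℚᵘ.*-cong (ℚ.toℚᵘ-fromℚᵘ p) (ℚ.toℚᵘ-fromℚᵘ q)) (ℚᵘ.≃-sym (ℚ.toℚᵘ-fromℚᵘ (p ℚᵘ.* q)))))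

  /-mono-≤ : ∀ a b c d → a ℕ.* suc d ℕ.≤ c ℕ.* suc b → ℤ.+ a ℚ./ suc b ℚ.≤ ℤ.+ c ℚ./ suc d
  /-mono-≤ a b c d le = fromℚᵘ-mono-≤ {mkℚᵘ (ℤ.+ a) b} {mkℚᵘ (ℤ.+ c) d}
    (ℚᵘ.*≤* (subst₂ ℤ._≤_ (ℤ.pos-* a (suc d)) (ℤ.pos-* c (suc b)) (ℤ.+≤+ le)))

  /-homo-+ : ∀ a b k → (ℤ.+ a ℚ./ suc k) ℚ.+ (ℤ.+ b ℚ./ suc k) ≡ ℤ.+ (a ℕ.+ b) ℚ./ suc k
  /-homo-+ a b k = trans (fromℚᵘ-homo-+ (mkℚᵘ (ℤ.+ a) k) (mkℚᵘ (ℤ.+ b) k))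
    (ℚ.fromℚᵘ-cong {mkℚᵘ (ℤ.+ a) k ℚᵘ.+ mkℚᵘ (ℤ.+ b) k} {mkℚᵘ (ℤ.+ (a ℕ.+ b)) k} (ℚᵘ.*≡*
      (trans (cong (ℤ._* K) (sym (ℤ.*-distribʳ-+ K (ℤ.+ a) (ℤ.+ b))))
      (trans (ℤ.*-assoc (ℤ.+ a ℤ.+ ℤ.+ b) K K)
             (cong ((ℤ.+ a ℤ.+ ℤ.+ b) ℤ.*_) (sym (ℤ.pos-* (suc k) (suc k))))))))
    where K = ℤ.+ suc k

  /-homo-* : ∀ a b m n → (ℤ.+ a ℚ./ suc m) ℚ.* (ℤ.+ b ℚ./ suc n) ≡ ℤ.+ (a ℕ.* b) ℚ./ (suc m ℕ.* suc n)
  /-homo-* a b m n = trans (fromℚᵘ-homo-* (mkℚᵘ (ℤ.+ a) m) (mkℚᵘ (ℤ.+ b) n))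
    (cong (ℚ._/ (suc m ℕ.* suc n)) (sym (ℤ.pos-* a b)))

  archimedean : ∀ C δ → 0ℚ ℚ.< δ → ∃ λ N → ∀ n → N ℕ.≤ n → ℤ.+ C ℚ./ suc n ℚ.≤ δ
  archimedean C δ@(mkℚ ℤ.+[1+ a ] b _) δ>0 = C ℕ.* suc b , λ n N≤n →
    subst (ℤ.+ C ℚ./ suc n ℚ.≤_) (ℚ.fromℚᵘ-toℚᵘ δ) (/-mono-≤ C n (suc a) b
      (ℕ.≤-trans N≤n (ℕ.≤-trans (ℕ.n≤1+n n) (ℕ.m≤m+n (suc n) (a ℕ.* suc n)))))
  archimedean C (mkℚ (ℤ.+ 0) b c) δ>0 = contradiction (ℚ.positive δ>0) λ ()
  archimedean C (mkℚ ℤ.-[1+ a ] b c) δ>0 = contradiction (ℚ.positive δ>0) λ ()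

  square-cancel-≤ : ∀ a b → a ℕ.* a ℕ.≤ b ℕ.* b → a ℕ.≤ b
  square-cancel-≤ a b aa≤bb with a ℕ.≤? b
  ... | yes a≤b = a≤b
  ... | no  a≰b = contradiction aa≤bb (ℕ.<⇒≱ (ℕ.*-mono-< (ℕ.≰⇒> a≰b) (ℕ.≰⇒> a≰b)))

  ∣-∣≤-intro : ∀ p q {δ} → p ℚ.≤ q ℚ.+ δ → q ℚ.≤ p ℚ.+ δ → ℚ.∣ p ℚ.- q ∣ ℚ.≤ δ
  ∣-∣≤-intro p q {δ} p≤ q≤ = ∣p∣≤-intro (p ℚ.- q)
    (subst (p ℚ.- q ℚ.≤_) (eq₁ q δ) (ℚ.+-monoˡ-≤ (ℚ.- q) p≤))
    (subst₂ ℚ._≤_ (eq₂ p q) (eq₁ p δ) (ℚ.+-monoˡ-≤ (ℚ.- p) q≤))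
    where
    open ℚSolver.+-*-Solver
    eq₁ : ∀ q δ → (q ℚ.+ δ) ℚ.- q ≡ δ
    eq₁ = solve 2 (λ q δ → (q :+ δ) :- q := δ) refl
    eq₂ : ∀ p q → q ℚ.- p ≡ ℚ.- (p ℚ.- q)
    eq₂ = solve 2 (λ p q → q :- p := :- (p :- q)) refl

  √-seq-step : ∀ d m n → √-seq d m ℚ.≤ √-seq d n ℚ.+ (ℤ.+ 1 ℚ./ suc n)
  √-seq-step d m n = subst (√-seq d m ℚ.≤_) (sym (/-homo-+ s 1 n))
    (/-mono-≤ r m (s ℕ.+ 1) n (square-cancel-≤ (r ℕ.* N) ((s ℕ.+ 1) ℕ.* M) squares))
    where
    M = suc m
    N = suc n
    r = isqrt (d ℕ.* (M ℕ.* M))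
    s = isqrt (d ℕ.* (N ℕ.* N))
    open +-*-Solver
    open ℕ.≤-Reasoning
    squares : (r ℕ.* N) ℕ.* (r ℕ.* N) ℕ.≤ ((s ℕ.+ 1) ℕ.* M) ℕ.* ((s ℕ.+ 1) ℕ.* M)
    squares = begin
      (r ℕ.* N) ℕ.* (r ℕ.* N)
        ≡⟨ ℕ.[m*n]*[o*p]≡[m*o]*[n*p] r N r N ⟩
      (r ℕ.* r) ℕ.* (N ℕ.* N)
        ≤⟨ ℕ.*-monoˡ-≤ (N ℕ.* N) (isqrt-lower (d ℕ.* (M ℕ.* M))) ⟩
      (d ℕ.* (M ℕ.* M)) ℕ.* (N ℕ.* N)
        ≡⟨ solve 3 (λ d a b → (d :* a) :* b := (d :* b) :* a) refl d (M ℕ.* M) (N ℕ.* N) ⟩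
      (d ℕ.* (N ℕ.* N)) ℕ.* (M ℕ.* M)
        ≤⟨ ℕ.*-monoˡ-≤ (M ℕ.* M) (ℕ.<⇒≤ (isqrt-upper (d ℕ.* (N ℕ.* N)))) ⟩
      (suc s ℕ.* suc s) ℕ.* (M ℕ.* M)
        ≡⟨ cong (λ t → (t ℕ.* t) ℕ.* (M ℕ.* M)) (ℕ.+-comm 1 s) ⟩
      ((s ℕ.+ 1) ℕ.* (s ℕ.+ 1)) ℕ.* (M ℕ.* M)
        ≡⟨ ℕ.[m*n]*[o*p]≡[m*o]*[n*p] (s ℕ.+ 1) (s ℕ.+ 1) M M ⟩
      ((s ℕ.+ 1) ℕ.* M) ℕ.* ((s ℕ.+ 1) ℕ.* M) ∎

  √-seq-~ : ∀ d → √-seq d ~ √-seq d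
  √-seq-~ d δ δ>0 with archimedean 1 δ δ>0
  ... | N , small = N , λ m n N≤m N≤n → ∣-∣≤-intro (√-seq d m) (√-seq d n)
    (ℚ.≤-trans (√-seq-step d m n) (ℚ.+-monoʳ-≤ (√-seq d n) (small n N≤n)))
    (ℚ.≤-trans (√-seq-step d n m) (ℚ.+-monoʳ-≤ (√-seq d m) (small m N≤m)))

  √-seq²-~ : ∀ d → (λ n → √-seq d n ℚ.* √-seq d n) ~ (λ _ → ℤ.+ d ℚ./ 1)
  √-seq²-~ d δ δ>0 with archimedean (2 ℕ.* d ℕ.+ 1) δ δ>0
  ... | K , small = K , λ m _ K≤m _ →
    ∣-∣≤-intro (√-seq d m ℚ.* √-seq d m) (ℤ.+ d ℚ./ 1) (lower m) (upper m (small m K≤m))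
    where
    open +-*-Solver
    open ℕ.≤-Reasoning

    root : ℕ → ℕ
    root m = isqrt (d ℕ.* (suc m ℕ.* suc m))

    square : ∀ m → √-seq d m ℚ.* √-seq d m ≡ ℤ.+ (root m ℕ.* root m) ℚ./ (suc m ℕ.* suc m)
    square m = /-homo-* (root m) (root m) m m

    lower : ∀ m → √-seq d m ℚ.* √-seq d m ℚ.≤ (ℤ.+ d ℚ./ 1) ℚ.+ δ
    lower m = ℚ.≤-trans
      (subst (ℚ._≤ ℤ.+ d ℚ./ 1) (sym (square m))
        (/-mono-≤ (root m ℕ.* root m) (m ℕ.+ m ℕ.* suc m) d 0
          (subst (ℕ._≤ d ℕ.* (suc m ℕ.* suc m)) (sym (ℕ.*-identityʳ (root m ℕ.* root m)))
            (isqrt-lower (d ℕ.* (suc m ℕ.* suc m))))))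
      (subst (ℚ._≤ (ℤ.+ d ℚ./ 1) ℚ.+ δ) (ℚ.+-identityʳ (ℤ.+ d ℚ./ 1))
        (ℚ.+-monoʳ-≤ (ℤ.+ d ℚ./ 1) (ℚ.<⇒≤ δ>0)))

    d≤d*d : ∀ d → d ℕ.≤ d ℕ.* d
    d≤d*d zero    = z≤n
    d≤d*d (suc d) = ℕ.m≤m+n (suc d) (d ℕ.* suc d)

    root≤ : ∀ N → isqrt (d ℕ.* (N ℕ.* N)) ℕ.≤ d ℕ.* N
    root≤ N = square-cancel-≤ _ (d ℕ.* N) (begin
      isqrt (d ℕ.* (N ℕ.* N)) ℕ.* isqrt (d ℕ.* (N ℕ.* N)) ≤⟨ isqrt-lower _ ⟩
      d ℕ.* (N ℕ.* N)                                     ≤⟨ ℕ.*-monoˡ-≤ (N ℕ.* N) (d≤d*d d) ⟩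
      (d ℕ.* d) ℕ.* (N ℕ.* N)                             ≡⟨ ℕ.[m*n]*[o*p]≡[m*o]*[n*p] d d N N ⟩
      (d ℕ.* N) ℕ.* (d ℕ.* N)                             ∎)

    error≤ : ∀ r N .{{_ : ℕ.NonZero N}} → r ℕ.≤ d ℕ.* N →
             (2 ℕ.* r ℕ.+ 1) ℕ.* N ℕ.≤ (2 ℕ.* d ℕ.+ 1) ℕ.* (N ℕ.* N)
    error≤ r N r≤dN = begin
      (2 ℕ.* r ℕ.+ 1) ℕ.* N
        ≤⟨ ℕ.*-monoˡ-≤ N (ℕ.+-mono-≤ (ℕ.*-monoʳ-≤ 2 r≤dN) (ℕ.>-nonZero⁻¹ N)) ⟩
      (2 ℕ.* (d ℕ.* N) ℕ.+ N) ℕ.* N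
        ≡⟨ solve 2 (λ d N → (con 2 :* (d :* N) :+ N) :* N := (con 2 :* d :+ con 1) :* (N :* N)) refl d N ⟩
      (2 ℕ.* d ℕ.+ 1) ℕ.* (N ℕ.* N) ∎

    upper : ∀ m → ℤ.+ (2 ℕ.* d ℕ.+ 1) ℚ./ suc m ℚ.≤ δ →
            ℤ.+ d ℚ./ 1 ℚ.≤ √-seq d m ℚ.* √-seq d m ℚ.+ δ
    upper m small = ℚ.≤-trans
      (subst (ℤ.+ d ℚ./ 1 ℚ.≤_) (sym (/-homo-+ (r ℕ.* r) e k)) (/-mono-≤ d 0 (r ℕ.* r ℕ.+ e) k (begin
        d ℕ.* (suc m ℕ.* suc m)          ≤⟨ ℕ.<⇒≤ (isqrt-upper _) ⟩
        suc r ℕ.* suc r                  ≡⟨ solve 1 (λ r → (con 1 :+ r) :* (con 1 :+ r)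
                                              := (r :* r :+ (con 2 :* r :+ con 1)) :* con 1) refl r ⟩
        (r ℕ.* r ℕ.+ e) ℕ.* 1            ∎)))
      (ℚ.+-mono-≤ (ℚ.≤-reflexive (sym (square m)))
        (ℚ.≤-trans (/-mono-≤ e k (2 ℕ.* d ℕ.+ 1) m (error≤ r (suc m) (root≤ (suc m)))) small))
      where
      r = isqrt (d ℕ.* (suc m ℕ.* suc m))
      e = 2 ℕ.* r ℕ.+ 1
      k = m ℕ.+ m ℕ.* suc m

open √-Properties

-- The terms of the sequence are nonnegative, so this is the nonnegative
-- root.
√ : ℕ → ℝ
√ d .seq    = √-seq d
√ d .cauchy = √-seq-~ d

√-square : ∀ d → √ d * √ d ≈ fromℕ d
√-square d = mk≈ (√-seq²-~ d)

1/ℕ-inverse : ∀ n .{{_ : ℕ.NonZero n}} → fromℕ n * 1/ℕ n ≈ 1ℝ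
1/ℕ-inverse n@(suc k) = pointwise (fromℕ n * 1/ℕ n) 1ℝ λ _ →
  trans (/-homo-* n 1 0 k) (ℚ.fromℚᵘ-cong {mkℚᵘ (ℤ.+ (n ℕ.* 1)) (k ℕ.+ 0)} {mkℚᵘ (ℤ.+ 1) 0}
    (ℚᵘ.*≡* (trans (ℤ.*-identityʳ (ℤ.+ (n ℕ.* 1)))
      (trans (cong ℤ.+_ (trans (ℕ.*-identityʳ n) (cong suc (sym (ℕ.+-identityʳ k)))))
             (sym (ℤ.*-identityˡ (ℤ.+ suc (k ℕ.+ 0))))))))

-- 1 / √ d, computed as √ d / d.
1/√ : (d : ℕ) → .{{ℕ.NonZero d}} → ℝ
1/√ d = √ d * 1/ℕ d

1/√-inverse : ∀ d .{{_ : ℕ.NonZero d}} → √ d * 1/√ d ≈ 1ℝ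
1/√-inverse d = begin
  √ d * (√ d * 1/ℕ d)   ≈⟨ R.*-assoc (√ d) (√ d) (1/ℕ d) ⟨
  (√ d * √ d) * 1/ℕ d   ≈⟨ R.*-congʳ (√-square d) ⟩
  fromℕ d * 1/ℕ d       ≈⟨ 1/ℕ-inverse d ⟩
  1ℝ                    ∎
  where
  module R = CommutativeRing ℝ-commutativeRing
  open import Relation.Binary.Reasoning.Setoid R.setoid

infixl 6 _-_

_-_ : ℝ → ℝ → ℝ
a - b = a + - b

open import Algebra.Properties.Semiring.Sum (CommutativeRing.semiring ℝ-commutativeRing) public
  using (sum; sum-syntax)

Matrix : ℕ → Set
Matrix n = Fin n → Fin n → ℝ

diagonal : ∀ {n} → Vector ℝ n → Matrix n
diagonal d i j = if does (i Fin.≟ j) then d i else 0ℝ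

identity : ∀ n → Matrix n
identity n = diagonal (λ _ → 1ℝ)

infixl 6 _⊖_
infixl 7 _⊗_ _·_

_⊖_ _⊗_ : ∀ {n} → Matrix n → Matrix n → Matrix n
(M ⊖ N) i j = M i j - N i j
_⊗_ {n} M N i j = ∑[ l < n ] (M i l * N l j)

_·_ : ∀ {n} → Matrix n → Vector ℝ n → Vector ℝ n
_·_ {n} M v i = ∑[ j < n ] (M i j * v j)

⟨_,_⟩ : ∀ {n} → Vector ℝ n → Vector ℝ n → ℝ
⟨_,_⟩ {n} v w = ∑[ x < n ] (v x * w x)

InEigenspace : ∀ {n} → Matrix n → ℝ → Vector ℝ n → Set
InEigenspace M μ v = ∀ x → (M · v) x ≈ μ * v x

-- A nonzero eigenvector is only required to be not equal to 0, which is
-- constructively weaker than having an entry apart from 0.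
IsEigenvalue : ∀ {n} → Matrix n → ℝ → Set
IsEigenvalue {n} M μ = Σ (Vector ℝ n) λ v → (¬ (∀ x → v x ≈ 0ℝ)) × InEigenspace M μ v

-- Linear independence is not a separate field: it follows from
-- orthonormality.
record IsOrthonormalEigenbasis {n k : ℕ} (M : Matrix n) (μ : ℝ)
                               (v : Fin k → Vector ℝ n) : Set where
  field
    inEigenspace : ∀ i → InEigenspace M μ (v i)
    orthonormal  : ∀ i j → ⟨ v i , v j ⟩ ≈ identity k i j
    spanning     : ∀ w → InEigenspace M μ w →
                   Σ (Vector ℝ k) λ c → ∀ x → w x ≈ ∑[ i < k ] (c i * v i x)

multiplicity-nonZero : ∀ {n k} {M : Matrix n} {μ} {v : Fin k → Vector ℝ n} →
                       IsEigenvalue M μ → IsOrthonormalEigenbasis M μ v → ℕ.NonZero k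
multiplicity-nonZero {k = zero} (w , w≉0 , w∈E) basis =
  contradiction (proj₂ (IsOrthonormalEigenbasis.spanning basis w w∈E)) w≉0
multiplicity-nonZero {k = suc _} _ _ = _

record SimpleGraph (n : ℕ) : Set₁ where
  field
    Adj         : Rel (Fin n) 0ℓ
    adj?        : Decidable Adj
    symmetric   : Symmetric Adj
    irreflexive : Irreflexive _≡_ Adj

open SimpleGraph public

Connected : ∀ {n} → SimpleGraph n → Set
Connected G = ∀ x y → Star (Adj G) x y

IsAutomorphism : ∀ {n} → SimpleGraph n → Permutation′ n → Set
IsAutomorphism G φ = ∀ x y → Adj G x y ⇔ Adj G (φ ⟨$⟩ʳ x) (φ ⟨$⟩ʳ y)

-- Edges are unordered, so φ may map the pair (x , y) to (u , v) or to
-- (v , u).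
EdgeTransitive : ∀ {n} → SimpleGraph n → Set
EdgeTransitive {n} G = ∀ {x y u v} → Adj G x y → Adj G u v →
  Σ (Permutation′ n) λ φ → IsAutomorphism G φ ×
    ((φ ⟨$⟩ʳ x ≡ u × φ ⟨$⟩ʳ y ≡ v) ⊎ (φ ⟨$⟩ʳ x ≡ v × φ ⟨$⟩ʳ y ≡ u))

degree : ∀ {n} → SimpleGraph n → Fin n → ℕ
degree {n} G x = length (filter (adj? G x) (allFin n))

adjacencyMatrix : ∀ {n} → SimpleGraph n → Matrix n
adjacencyMatrix G x y = if does (adj? G x y) then 1ℝ else 0ℝ

private
  ∈⇒length-nonZero : ∀ {A : Set} {a : A} {as} → a ∈ as → ℕ.NonZero (length as)
  ∈⇒length-nonZero (here _)  = _
  ∈⇒length-nonZero (there _) = _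

  other : ∀ {n} → 2 ℕ.≤ n → (x : Fin n) → ∃ λ y → x ≢ y
  other (s≤s (s≤s _)) zero    = suc zero , λ ()
  other (s≤s (s≤s _)) (suc x) = zero , λ ()

degree-nonZero : ∀ {n} (G : SimpleGraph n) → 2 ℕ.≤ n → Connected G → ∀ x → ℕ.NonZero (degree G x)
degree-nonZero G 2≤n connected x with other 2≤n x
... | y , x≢y with connected x y
...   | ε           = contradiction refl x≢y
...   | x~z ◅ _     = ∈⇒length-nonZero (∈-filter⁺ (adj? G x) (∈-allFin _) x~z)

module NormalizedLaplacian {n : ℕ} (G : SimpleGraph n) (2≤n : 2 ℕ.≤ n) (connected : Connected G) where

  private
    d : Fin n → ℕ
    d = degree G

    instance
      d≢0 : ∀ {x} → ℕ.NonZero (d x)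
      d≢0 {x} = degree-nonZero G 2≤n connected x

  D^-½ : Matrix n
  D^-½ = diagonal (λ x → 1/√ (d x))

  𝓛 : Matrix n
  𝓛 = identity n ⊖ D^-½ ⊗ adjacencyMatrix G ⊗ D^-½

  edgeDerivative : (μ : ℝ) → IsEigenvalue 𝓛 μ →
                   ∀ {k} (v : Fin k → Vector ℝ n) → IsOrthonormalEigenbasis 𝓛 μ v →
                   Fin n → Fin n → ℝ
  edgeDerivative μ eigenvalue {k} v basis x y =
    1/ℕ k * ∑[ i < k ]
      ((1ℝ - μ) * (v i x * v i x * 1/ℕ (d x) + v i y * v i y * 1/ℕ (d y))
        - fromℕ 2 * (v i x * v i y * 1/√ (d x ℕ.* d y)))
    where
    instance
      k≢0 : ℕ.NonZero k
      k≢0 = multiplicity-nonZero eigenvalue basis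
      dxdy≢0 : ℕ.NonZero (d x ℕ.* d y)
      dxdy≢0 = ℕ.m*n≢0 (d x) (d y)

{-# OPTIONS --safe #-}

-- For an orthonormal basis v of the λ-eigenspace, the kernel
-- P x y = Σᵢ vᵢ x vᵢ y does not depend on the basis, hence is invariant
-- under automorphisms.  With K x y = P x y / √(d x d y), the edge
-- derivative is 1/k times (1 - λ)(K x x + K y y) - 2 K x y, so by edge
-- transitivity both K x x + K y y and K x y are constant on edges.
-- Summing over the m ordered pairs of adjacent vertices, the eigenvalue
-- equation gives m (K x x + K y y) = 2 Σₓ P x x and
-- m (K x y) = (1 - λ) Σₓ P x x, so the two terms cancel.
module Submission where

open import Algebra.Bundles using (CommutativeRing)
import Algebra.Properties.AbelianGroup as AbelianGroupProperties
import Algebra.Properties.CommutativeMonoid.Sum as MonoidSum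
import Algebra.Properties.Ring as RingProperties
import Algebra.Properties.Semiring.Sum as SemiringSum
import Algebra.Solver.Ring.NaturalCoefficients.Default as NaturalCoefficients
open import Data.Bool.Base using (true; false; if_then_else_)
open import Data.Fin.Base using (Fin; zero; suc)
open import Data.Fin.Permutation using (Permutation′; _⟨$⟩ʳ_; _⟨$⟩ˡ_; flip; inverseˡ; inverseʳ)
import Data.Fin.Properties as Fin
import Data.Integer.Base as ℤ
open import Data.List.Base using (length; filter; tabulate)
open import Data.Nat.Base as ℕ using (ℕ; zero; suc; _≤_)
import Data.Nat.Properties as ℕ
open import Data.Nat.Solver using (module +-*-Solver)
open import Data.Product.Base using (_,_)
import Data.Rational.Base as ℚ
import Data.Rational.Properties as ℚ
open import Data.Sum.Base using (inj₁; inj₂)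
open import Data.Vec.Functional using (Vector)
open import Function.Base using (id; _∘_)
open import Function.Bundles using (Injection; mk⇔)
open import Function.Properties.Inverse using (↔⇒↣)
open import Relation.Binary.PropositionalEquality as ≡
  using (_≡_; refl; cong; cong₂; subst)
open import Relation.Nullary using (does; yes; no)
open import Relation.Nullary.Decidable using (does-⇔)
open import Relation.Unary using (Pred; Decidable)
open import Level using (0ℓ)
open import Defs
open Sequences
open √-Properties
open ℝ-Properties

private
  module R = CommutativeRing ℝ-commutativeRing
  module ℕ∑ = MonoidSum ℕ.+-0-commutativeMonoid

open AbelianGroupProperties R.+-abelianGroup using (⁻¹-∙-comm; ⁻¹-anti-homo-//; x≈y⇒x∙y⁻¹≈ε)
open RingProperties R.ring using ([y-z]x≈yx-zx)
open SemiringSum R.semiring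
  using (sum-cong-≋; *-distribˡ-sum; *-distribʳ-sum; ∑-distrib-+; ∑-comm; ∑-permute)

-- Multiplicativity of the square root on natural numbers.

module √-Product where

  open +-*-Solver
  open ℕ.≤-Reasoning

  -- For `N = suc n` these roots are the numerators of the approximations to `√ a`, `√ b` and
  -- `√ (a ℕ.* b)`. Comparing squares reduces the bound to `isqrt-lower` for the two factors and
  -- `isqrt-upper` for the product; the `suc` absorbs the rounding of the latter.
  isqrt-*-≤ : ∀ a b N → isqrt (a ℕ.* (N ℕ.* N)) ℕ.* isqrt (b ℕ.* (N ℕ.* N))
              ≤ suc (isqrt (a ℕ.* b ℕ.* (N ℕ.* N))) ℕ.* N
  isqrt-*-≤ a b N = square-cancel-≤ (p ℕ.* q) (suc r ℕ.* N) (begin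
    (p ℕ.* q) ℕ.* (p ℕ.* q)           ≡⟨ ℕ.[m*n]*[o*p]≡[m*o]*[n*p] p q p q ⟩
    (p ℕ.* p) ℕ.* (q ℕ.* q)           ≤⟨ ℕ.*-mono-≤ (isqrt-lower (a ℕ.* S)) (isqrt-lower (b ℕ.* S)) ⟩
    (a ℕ.* S) ℕ.* (b ℕ.* S)           ≡⟨ solve 3 (λ a b S → (a :* S) :* (b :* S) := (a :* b :* S) :* S) refl a b S ⟩
    (a ℕ.* b ℕ.* S) ℕ.* S             ≤⟨ ℕ.*-monoˡ-≤ S (ℕ.<⇒≤ (isqrt-upper (a ℕ.* b ℕ.* S))) ⟩
    (suc r ℕ.* suc r) ℕ.* S           ≡⟨ ℕ.[m*n]*[o*p]≡[m*o]*[n*p] (suc r) (suc r) N N ⟩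
    (suc r ℕ.* N) ℕ.* (suc r ℕ.* N)   ∎)
    where
    S = N ℕ.* N
    p = isqrt (a ℕ.* S)
    q = isqrt (b ℕ.* S)
    r = isqrt (a ℕ.* b ℕ.* S)

  -- Follows from `a ≤ a * a`. The bound is crude, but it is linear in `N`, which is all that the
  -- error estimate requires.
  isqrt-≤ : ∀ a N → isqrt (a ℕ.* (N ℕ.* N)) ≤ a ℕ.* N
  isqrt-≤ zero      N = ℕ.z≤n
  isqrt-≤ a@(suc _) N = square-cancel-≤ p (a ℕ.* N) (begin
    p ℕ.* p                   ≤⟨ isqrt-lower (a ℕ.* (N ℕ.* N)) ⟩
    a ℕ.* (N ℕ.* N)           ≤⟨ ℕ.*-monoˡ-≤ (N ℕ.* N) (ℕ.m≤m*n a a) ⟩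
    (a ℕ.* a) ℕ.* (N ℕ.* N)   ≡⟨ ℕ.[m*n]*[o*p]≡[m*o]*[n*p] a a N N ⟩
    (a ℕ.* N) ℕ.* (a ℕ.* N)   ∎)
    where p = isqrt (a ℕ.* (N ℕ.* N))

  -- The constant `C` for which the approximations to `√ (a ℕ.* b)` and `√ a * √ b` at index `n`
  -- differ by at most `C / (n + 1)`.
  error : ℕ → ℕ → ℕ
  error a b = a ℕ.+ b ℕ.+ 1

  -- Squares are compared again, now with `isqrt-lower` for the product and `isqrt-upper` for the
  -- factors. Multiplying out `suc p * suc q` leaves the surplus `p + q + 1`, and `isqrt-≤` bounds
  -- it by `error a b * N`.
  isqrt-*-≥ : ∀ a b N .{{_ : ℕ.NonZero N}} → isqrt (a ℕ.* b ℕ.* (N ℕ.* N)) ℕ.* N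
              ≤ isqrt (a ℕ.* (N ℕ.* N)) ℕ.* isqrt (b ℕ.* (N ℕ.* N)) ℕ.+ error a b ℕ.* N
  isqrt-*-≥ a b N = begin
    r ℕ.* N                                   ≤⟨ square-cancel-≤ (r ℕ.* N) (suc p ℕ.* suc q) squares ⟩
    suc p ℕ.* suc q                           ≡⟨ solve 2 (λ p q → (con 1 :+ p) :* (con 1 :+ q)
                                                   := p :* q :+ (p :+ q :+ con 1)) refl p q ⟩
    p ℕ.* q ℕ.+ (p ℕ.+ q ℕ.+ 1)               ≤⟨ ℕ.+-monoʳ-≤ (p ℕ.* q)
                                                   (ℕ.+-mono-≤ (ℕ.+-mono-≤ (isqrt-≤ a N) (isqrt-≤ b N)) (ℕ.>-nonZero⁻¹ N)) ⟩
    p ℕ.* q ℕ.+ (a ℕ.* N ℕ.+ b ℕ.* N ℕ.+ N)   ≡⟨ cong (p ℕ.* q ℕ.+_) (solve 3 (λ a b N → a :* N :+ b :* N :+ N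
                                                   := (a :+ b :+ con 1) :* N) refl a b N) ⟩
    p ℕ.* q ℕ.+ error a b ℕ.* N               ∎
    where
    S = N ℕ.* N
    p = isqrt (a ℕ.* S)
    q = isqrt (b ℕ.* S)
    r = isqrt (a ℕ.* b ℕ.* S)
    squares : (r ℕ.* N) ℕ.* (r ℕ.* N) ≤ (suc p ℕ.* suc q) ℕ.* (suc p ℕ.* suc q)
    squares = begin
      (r ℕ.* N) ℕ.* (r ℕ.* N)                   ≡⟨ ℕ.[m*n]*[o*p]≡[m*o]*[n*p] r N r N ⟩
      (r ℕ.* r) ℕ.* S                           ≤⟨ ℕ.*-monoˡ-≤ S (isqrt-lower (a ℕ.* b ℕ.* S)) ⟩
      (a ℕ.* b ℕ.* S) ℕ.* S                     ≡⟨ solve 3 (λ a b S → (a :* b :* S) :* S := (a :* S) :* (b :* S)) refl a b S ⟩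
      (a ℕ.* S) ℕ.* (b ℕ.* S)                   ≤⟨ ℕ.*-mono-≤ (ℕ.<⇒≤ (isqrt-upper (a ℕ.* S))) (ℕ.<⇒≤ (isqrt-upper (b ℕ.* S))) ⟩
      (suc p ℕ.* suc p) ℕ.* (suc q ℕ.* suc q)   ≡⟨ ℕ.[m*n]*[o*p]≡[m*o]*[n*p] (suc p) (suc p) (suc q) (suc q) ⟩
      (suc p ℕ.* suc q) ℕ.* (suc p ℕ.* suc q)   ∎

  √-seq-*-close : ∀ a b n → ℚ.∣ √-seq (a ℕ.* b) n ℚ.- √-seq a n ℚ.* √-seq b n ∣
                  ℚ.≤ ℤ.+ error a b ℚ./ suc n
  √-seq-*-close a b n = ∣-∣≤-intro (√-seq (a ℕ.* b) n) (√-seq a n ℚ.* √-seq b n)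
    (subst (λ t → √-seq (a ℕ.* b) n ℚ.≤ t ℚ.+ (ℤ.+ C ℚ./ N)) (≡.sym product)
      (ℚ.≤-trans (/-mono-≤ r n (p ℕ.* q ℕ.+ C ℕ.* N) k upper)
        (subst (ℚ._≤ (ℤ.+ (p ℕ.* q) ℚ./ suc k) ℚ.+ (ℤ.+ C ℚ./ N)) (/-homo-+ (p ℕ.* q) (C ℕ.* N) k)
          (ℚ.+-monoʳ-≤ (ℤ.+ (p ℕ.* q) ℚ./ suc k)
            (/-mono-≤ (C ℕ.* N) k C n (ℕ.≤-reflexive (ℕ.*-assoc C N N)))))))
    (subst (ℚ._≤ √-seq (a ℕ.* b) n ℚ.+ (ℤ.+ C ℚ./ N)) (≡.sym product)
      (subst (ℤ.+ (p ℕ.* q) ℚ./ suc k ℚ.≤_) (≡.sym (/-homo-+ r C n))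
        (/-mono-≤ (p ℕ.* q) k (r ℕ.+ C) n lower)))
    where
    C = error a b
    N = suc n
    -- Chosen so that `suc k` computes to `N * N`, because `/-mono-≤` and `/-homo-+` expect
    -- denominators that are successors.
    k = n ℕ.+ n ℕ.* suc n
    p = isqrt (a ℕ.* (N ℕ.* N))
    q = isqrt (b ℕ.* (N ℕ.* N))
    r = isqrt (a ℕ.* b ℕ.* (N ℕ.* N))
    product : √-seq a n ℚ.* √-seq b n ≡ ℤ.+ (p ℕ.* q) ℚ./ (N ℕ.* N)
    product = /-homo-* p q n n
    upper : r ℕ.* (N ℕ.* N) ≤ (p ℕ.* q ℕ.+ C ℕ.* N) ℕ.* N
    upper = begin
      r ℕ.* (N ℕ.* N)                   ≡⟨ ℕ.*-assoc r N N ⟨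
      (r ℕ.* N) ℕ.* N                   ≤⟨ ℕ.*-monoˡ-≤ N (isqrt-*-≥ a b N) ⟩
      (p ℕ.* q ℕ.+ C ℕ.* N) ℕ.* N       ∎
    lower : (p ℕ.* q) ℕ.* N ≤ (r ℕ.+ C) ℕ.* (N ℕ.* N)
    lower = begin
      (p ℕ.* q) ℕ.* N           ≤⟨ ℕ.*-monoˡ-≤ N (isqrt-*-≤ a b N) ⟩
      (suc r ℕ.* N) ℕ.* N       ≡⟨ ℕ.*-assoc (suc r) N N ⟩
      suc r ℕ.* (N ℕ.* N)       ≡⟨ cong (ℕ._* (N ℕ.* N)) (ℕ.+-comm 1 r) ⟩
      (r ℕ.+ 1) ℕ.* (N ℕ.* N)   ≤⟨ ℕ.*-monoˡ-≤ (N ℕ.* N) (ℕ.+-monoʳ-≤ r (ℕ.m≤n+m 1 (a ℕ.+ b))) ⟩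
      (r ℕ.+ C) ℕ.* (N ℕ.* N)   ∎

  -- The relation `~` compares terms at independent indices, so closeness at equal indices is
  -- combined with the Cauchy property of `y`, each contributing half of `δ`.
  ~-close : ∀ {x y} C → y ~ y → (∀ n → ℚ.∣ x n ℚ.- y n ∣ ℚ.≤ ℤ.+ C ℚ./ suc n) → x ~ y
  ~-close {x} {y} C y~y close δ δ>0 with archimedean C (ℚ.½ ℚ.* δ) (half>0 δ>0) | y~y (ℚ.½ ℚ.* δ) (half>0 δ>0)
  ... | N₁ , small | N₂ , near = N₁ ℕ.⊔ N₂ , λ m n N≤m N≤n → ℚ.≤-trans
    (∣-∣-triangle (x m) (y m) (y n))
    (subst (ℚ.∣ x m ℚ.- y m ∣ ℚ.+ ℚ.∣ y m ℚ.- y n ∣ ℚ.≤_) (halves δ)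
      (ℚ.+-mono-≤ (ℚ.≤-trans (close m) (small m (ℕ.m⊔n≤o⇒m≤o N₁ N₂ N≤m)))
                  (near m n (ℕ.m⊔n≤o⇒n≤o N₁ N₂ N≤m) (ℕ.m⊔n≤o⇒n≤o N₁ N₂ N≤n))))

  -- The two sides are different rational sequences and agree only in the limit. This links the
  -- factor `1/√ (d x ℕ.* d y)` of the edge derivative to the separate factors of the diagonal
  -- matrix `D^-½`.
  √-* : ∀ a b → √ (a ℕ.* b) ≈ √ a * √ b
  √-* a b = mk≈ (~-close {√-seq (a ℕ.* b)} {seq (√ a * √ b)} (error a b) (cauchy (√ a * √ b)) (√-seq-*-close a b))

open √-Product using (√-*)
open NaturalCoefficients R.commutativeSemiring using (solve; _:=_; _:+_; _:*_; con)
open import Relation.Binary.Reasoning.Setoid R.setoid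

-- Embedded natural numbers, their reciprocals and inverse square roots.

fromℕ-+ : ∀ a b → fromℕ (a ℕ.+ b) ≈ fromℕ a + fromℕ b
fromℕ-+ a b = pointwise _ _ λ _ → ≡.sym (/-homo-+ a b 0)

1/ℕ-* : ∀ a b .{{_ : ℕ.NonZero a}} .{{_ : ℕ.NonZero b}} .{{_ : ℕ.NonZero (a ℕ.* b)}} →
        1/ℕ (a ℕ.* b) ≈ 1/ℕ a * 1/ℕ b
1/ℕ-* (suc a) (suc b) = pointwise _ _ λ _ → ≡.sym (/-homo-* 1 1 a b)

1/√-* : ∀ a b .{{_ : ℕ.NonZero a}} .{{_ : ℕ.NonZero b}} .{{_ : ℕ.NonZero (a ℕ.* b)}} →
        1/√ (a ℕ.* b) ≈ 1/√ a * 1/√ b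
1/√-* a b = begin
  √ (a ℕ.* b) * 1/ℕ (a ℕ.* b)         ≈⟨ *-cong (√-* a b) (1/ℕ-* a b) ⟩
  (√ a * √ b) * (1/ℕ a * 1/ℕ b)       ≈⟨ solve 4 (λ s t p q → (s :* t) :* (p :* q) := (s :* p) :* (t :* q)) R.refl (√ a) (√ b) (1/ℕ a) (1/ℕ b) ⟩
  (√ a * 1/ℕ a) * (√ b * 1/ℕ b)       ∎

1/√-square : ∀ a .{{_ : ℕ.NonZero a}} → 1/√ a * 1/√ a ≈ 1/ℕ a
1/√-square a = begin
  (√ a * 1/ℕ a) * (√ a * 1/ℕ a)   ≈⟨ solve 2 (λ s p → (s :* p) :* (s :* p) := ((s :* s) :* p) :* p) R.refl (√ a) (1/ℕ a) ⟩
  (√ a * √ a * 1/ℕ a) * 1/ℕ a     ≈⟨ R.*-congʳ (R.*-congʳ (√-square a)) ⟩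
  (fromℕ a * 1/ℕ a) * 1/ℕ a       ≈⟨ R.*-congʳ (1/ℕ-inverse a) ⟩
  1ℝ * 1/ℕ a                      ≈⟨ R.*-identityˡ (1/ℕ a) ⟩
  1/ℕ a                           ∎

-- The two `NonZero` arguments are irrelevant, so they agree once `a` and `b` are identified.
1/√-cong : ∀ {a b} .{{_ : ℕ.NonZero a}} .{{_ : ℕ.NonZero b}} → a ≡ b → 1/√ a ≡ 1/√ b
1/√-cong refl = refl

fromℕ-cancel : ∀ m .{{_ : ℕ.NonZero m}} {a b} → fromℕ m * a ≈ b → a ≈ 1/ℕ m * b
fromℕ-cancel m {a} {b} ma≈b = begin
  a                       ≈⟨ R.*-identityˡ a ⟨
  1ℝ * a                  ≈⟨ R.*-congʳ (1/ℕ-inverse m) ⟨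
  (fromℕ m * 1/ℕ m) * a   ≈⟨ solve 3 (λ m p a → (m :* p) :* a := p :* (m :* a)) R.refl (fromℕ m) (1/ℕ m) a ⟩
  1/ℕ m * (fromℕ m * a)   ≈⟨ R.*-congˡ ma≈b ⟩
  1/ℕ m * b               ∎

-- Finite sums

∑-neg : ∀ {n} (f : Vector ℝ n) → ∑[ i < n ] (- f i) ≈ - ∑[ i < n ] f i
∑-neg {zero}  f = pointwise _ _ λ _ → refl
∑-neg {suc n} f = R.trans (R.+-congˡ (∑-neg (f ∘ suc))) (⁻¹-∙-comm (f zero) (∑[ i < n ] f (suc i)))

∑-distrib-- : ∀ {n} (f g : Vector ℝ n) → ∑[ i < n ] (f i - g i) ≈ ∑[ i < n ] f i - ∑[ i < n ] g i
∑-distrib-- f g = R.trans (∑-distrib-+ f (-_ ∘ g)) (R.+-congˡ (∑-neg g))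

∑-diagonalˡ : ∀ {n} (d : Vector ℝ n) (f : Vector ℝ n) i → ∑[ j < n ] (diagonal d i j * f j) ≈ d i * f i
∑-diagonalˡ {suc n} d f zero = begin
  d zero * f zero + ∑[ j < n ] (0ℝ * f (suc j))   ≈⟨ R.+-congˡ (*-distribˡ-sum 0ℝ (f ∘ suc)) ⟨
  d zero * f zero + 0ℝ * ∑[ j < n ] f (suc j)     ≈⟨ R.+-congˡ (R.zeroˡ _) ⟩
  d zero * f zero + 0ℝ                            ≈⟨ R.+-identityʳ _ ⟩
  d zero * f zero                                 ∎
∑-diagonalˡ {suc n} d f (suc i) = begin
  0ℝ * f zero + ∑[ j < n ] (diagonal (d ∘ suc) i j * f (suc j))   ≈⟨ +-cong (R.zeroˡ _) (∑-diagonalˡ (d ∘ suc) (f ∘ suc) i) ⟩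
  0ℝ + d (suc i) * f (suc i)                                      ≈⟨ R.+-identityˡ _ ⟩
  d (suc i) * f (suc i)                                           ∎

∑-diagonalʳ : ∀ {n} (d : Vector ℝ n) (f : Vector ℝ n) j → ∑[ i < n ] (f i * diagonal d i j) ≈ f j * d j
∑-diagonalʳ {suc n} d f zero = begin
  f zero * d zero + ∑[ i < n ] (f (suc i) * 0ℝ)   ≈⟨ R.+-congˡ (*-distribʳ-sum 0ℝ (f ∘ suc)) ⟨
  f zero * d zero + ∑[ i < n ] f (suc i) * 0ℝ     ≈⟨ R.+-congˡ (R.zeroʳ _) ⟩
  f zero * d zero + 0ℝ                            ≈⟨ R.+-identityʳ _ ⟩
  f zero * d zero                                 ∎
∑-diagonalʳ {suc n} d f (suc j) = begin
  f zero * 0ℝ + ∑[ i < n ] (f (suc i) * diagonal (d ∘ suc) i j)   ≈⟨ +-cong (R.zeroʳ _) (∑-diagonalʳ (d ∘ suc) (f ∘ suc) j) ⟩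
  0ℝ + f (suc j) * d (suc j)                                      ≈⟨ R.+-identityˡ _ ⟩
  f (suc j) * d (suc j)                                           ∎

fromℕ-∑ : ∀ {n} (f : Vector ℕ n) → fromℕ (ℕ∑.sum f) ≈ ∑[ i < n ] fromℕ (f i)
fromℕ-∑ {zero}  f = R.refl
fromℕ-∑ {suc n} f = R.trans (fromℕ-+ (f zero) (ℕ∑.sum (f ∘ suc))) (R.+-congˡ (fromℕ-∑ (f ∘ suc)))

-- The argument of type `Fin n` excludes the empty sum; the first summand is then already positive.
ℕ∑-nonZero : ∀ {n} (f : Vector ℕ n) → Fin n → (∀ i → ℕ.NonZero (f i)) → ℕ.NonZero (ℕ∑.sum f)
ℕ∑-nonZero {suc n} f _ f≢0 = ℕ.>-nonZero
  (ℕ.≤-trans (ℕ.>-nonZero⁻¹ (f zero) {{f≢0 zero}}) (ℕ.m≤m+n (f zero) (ℕ∑.sum (f ∘ suc))))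

-- Turns a count into a sum, which can be reindexed by a permutation. The function `f` is arbitrary
-- so that the induction can pass to `f ∘ suc`; degrees are the case `f = id`.
length-filter-tabulate : ∀ {A : Set} {P : Pred A 0ℓ} (P? : Decidable P) {n} (f : Fin n → A) →
  length (filter P? (tabulate f)) ≡ ℕ∑.sum (λ i → if does (P? (f i)) then 1 else 0)
length-filter-tabulate P? {zero}  f = refl
length-filter-tabulate P? {suc n} f with does (P? (f zero))
... | true  = cong suc (length-filter-tabulate P? (f ∘ suc))
... | false = length-filter-tabulate P? (f ∘ suc)

-- Eigenbases

-- Pairing the expansion of `w` with `v j` leaves only the term of index `j`, by orthonormality.
coefficients : ∀ {n k} (v : Fin k → Vector ℝ n) → (∀ i j → ⟨ v i , v j ⟩ ≈ identity k i j) →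
               ∀ {w} (c : Vector ℝ k) → (∀ x → w x ≈ ∑[ i < k ] (c i * v i x)) →
               ∀ j → c j ≈ ⟨ w , v j ⟩
coefficients {n} {k} v orthonormal {w} c w≈ j = R.sym (begin
  ∑[ x < n ] (w x * v j x)                          ≈⟨ sum-cong-≋ (λ x → R.*-congʳ (w≈ x)) ⟩
  ∑[ x < n ] (∑[ i < k ] (c i * v i x) * v j x)     ≈⟨ sum-cong-≋ (λ x → *-distribʳ-sum (v j x) (λ i → c i * v i x)) ⟩
  ∑[ x < n ] ∑[ i < k ] (c i * v i x * v j x)       ≈⟨ ∑-comm (λ x i → c i * v i x * v j x) ⟩
  ∑[ i < k ] ∑[ x < n ] (c i * v i x * v j x)       ≈⟨ sum-cong-≋ (λ i → sum-cong-≋ (λ x → R.*-assoc (c i) (v i x) (v j x))) ⟩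
  ∑[ i < k ] ∑[ x < n ] (c i * (v i x * v j x))     ≈⟨ sum-cong-≋ (λ i → *-distribˡ-sum (c i) (λ x → v i x * v j x)) ⟨
  ∑[ i < k ] (c i * ⟨ v i , v j ⟩)                  ≈⟨ sum-cong-≋ (λ i → R.*-congˡ {c i} (orthonormal i j)) ⟩
  ∑[ i < k ] (c i * identity k i j)                 ≈⟨ ∑-diagonalʳ (λ _ → 1ℝ) c j ⟩
  c j * 1ℝ                                          ≈⟨ R.*-identityʳ (c j) ⟩
  c j                                               ∎)

⟨⟩-comm : ∀ {n} (v w : Vector ℝ n) → ⟨ v , w ⟩ ≈ ⟨ w , v ⟩
⟨⟩-comm v w = sum-cong-≋ (λ x → R.*-comm (v x) (w x))

-- For an orthonormal family this is the matrix of the orthogonal projection onto its span.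
kernel : ∀ {n k} → (Fin k → Vector ℝ n) → Matrix n
kernel {k = k} v x y = ∑[ i < k ] (v i x * v i y)

module _ {n : ℕ} {M : Matrix n} {μ : ℝ} where

  expansion : ∀ {k} {v : Fin k → Vector ℝ n} → IsOrthonormalEigenbasis M μ v →
              ∀ {w} → InEigenspace M μ w → ∀ x → w x ≈ ∑[ i < k ] (⟨ w , v i ⟩ * v i x)
  expansion {v = v} basis {w} w∈E x =
    let c , w≈ = IsOrthonormalEigenbasis.spanning basis w w∈E
    in R.trans (w≈ x) (sum-cong-≋ (λ i →
         R.*-congʳ (coefficients v (IsOrthonormalEigenbasis.orthonormal basis) c w≈ i)))

  -- Each `v i` is expanded in the basis `w`. After the two sums are exchanged, the inner sum over
  -- `i` is the expansion of `w j` in the basis `v`, so it collapses to `w j y`.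
  kernel-unique : ∀ {k l} {v : Fin k → Vector ℝ n} {w : Fin l → Vector ℝ n} →
                  IsOrthonormalEigenbasis M μ v → IsOrthonormalEigenbasis M μ w →
                  ∀ x y → kernel v x y ≈ kernel w x y
  kernel-unique {k} {l} {v} {w} basis-v basis-w x y = begin
    ∑[ i < k ] (v i x * v i y)                                    ≈⟨ sum-cong-≋ (λ i → R.*-congʳ (expansion basis-w (inEigenspace basis-v i) x)) ⟩
    ∑[ i < k ] (∑[ j < l ] (⟨ v i , w j ⟩ * w j x) * v i y)       ≈⟨ sum-cong-≋ (λ i → *-distribʳ-sum (v i y) (λ j → ⟨ v i , w j ⟩ * w j x)) ⟩
    ∑[ i < k ] ∑[ j < l ] (⟨ v i , w j ⟩ * w j x * v i y)         ≈⟨ ∑-comm (λ i j → ⟨ v i , w j ⟩ * w j x * v i y) ⟩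
    ∑[ j < l ] ∑[ i < k ] (⟨ v i , w j ⟩ * w j x * v i y)         ≈⟨ sum-cong-≋ (λ j → sum-cong-≋ (λ i → regroup i j)) ⟩
    ∑[ j < l ] ∑[ i < k ] (w j x * (⟨ w j , v i ⟩ * v i y))       ≈⟨ sum-cong-≋ (λ j → *-distribˡ-sum (w j x) (λ i → ⟨ w j , v i ⟩ * v i y)) ⟨
    ∑[ j < l ] (w j x * ∑[ i < k ] (⟨ w j , v i ⟩ * v i y))       ≈⟨ sum-cong-≋ (λ j → R.*-congˡ (expansion basis-v (inEigenspace basis-w j) y)) ⟨
    ∑[ j < l ] (w j x * w j y)                                    ∎
    where
    open IsOrthonormalEigenbasis using (inEigenspace)
    regroup : ∀ i j → ⟨ v i , w j ⟩ * w j x * v i y ≈ w j x * (⟨ w j , v i ⟩ * v i y)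
    regroup i j = R.trans (R.*-congʳ (R.*-congʳ (⟨⟩-comm (v i) (w j))))
      (solve 3 (λ p a b → p :* a :* b := a :* (p :* b)) R.refl ⟨ w j , v i ⟩ (w j x) (v i y))

-- Equivalently, `M` commutes with the permutation matrix of `φ`.
Invariant : ∀ {n} → Matrix n → Permutation′ n → Set
Invariant M φ = ∀ x y → M (φ ⟨$⟩ʳ x) (φ ⟨$⟩ʳ y) ≈ M x y

module _ {n : ℕ} {M : Matrix n} {μ : ℝ} where

  Invariant-flip : ∀ φ → Invariant M φ → Invariant M (flip φ)
  Invariant-flip φ inv x y = R.trans (R.sym (inv (φ ⟨$⟩ˡ x) (φ ⟨$⟩ˡ y)))
    (R.reflexive (cong₂ M (inverseʳ φ) (inverseʳ φ)))

  -- Invariance moves `φ` into both indices of `M`; reindexing the sum along `φ` then gives the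
  -- eigenvalue equation of `v` at `φ x`.
  InEigenspace-∘ : ∀ φ → Invariant M φ → ∀ {v} → InEigenspace M μ v → InEigenspace M μ (v ∘ (φ ⟨$⟩ʳ_))
  InEigenspace-∘ φ inv {v} v∈E x = begin
    ∑[ y < n ] (M x y * v (φ ⟨$⟩ʳ y))                       ≈⟨ sum-cong-≋ (λ y → R.*-congʳ (inv x y)) ⟨
    ∑[ y < n ] (M (φ ⟨$⟩ʳ x) (φ ⟨$⟩ʳ y) * v (φ ⟨$⟩ʳ y))     ≈⟨ ∑-permute (λ y → M (φ ⟨$⟩ʳ x) y * v y) φ ⟨
    ∑[ y < n ] (M (φ ⟨$⟩ʳ x) y * v y)                       ≈⟨ v∈E (φ ⟨$⟩ʳ x) ⟩
    μ * v (φ ⟨$⟩ʳ x)                                        ∎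

  eigenbasis-∘ : ∀ φ → Invariant M φ → ∀ {k} {v : Fin k → Vector ℝ n} →
                 IsOrthonormalEigenbasis M μ v → IsOrthonormalEigenbasis M μ (λ i → v i ∘ (φ ⟨$⟩ʳ_))
  eigenbasis-∘ φ inv {k} {v} basis = record
    { inEigenspace = λ i → InEigenspace-∘ φ inv (inEigenspace i)
    ; orthonormal  = λ i j → R.trans (R.sym (∑-permute (λ x → v i x * v j x) φ)) (orthonormal i j)
    -- The vector `w` is carried back along the inverse of `φ`, expanded there in `v`, and the
    -- expansion is evaluated at `φ x`.
    ; spanning     = λ w w∈E →
        let c , w≈ = spanning (w ∘ (φ ⟨$⟩ˡ_)) (InEigenspace-∘ (flip φ) (Invariant-flip φ inv) w∈E)
        in c , λ x → R.trans (R.reflexive (cong w (≡.sym (inverseˡ φ)))) (w≈ (φ ⟨$⟩ʳ x))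
    }
    where open IsOrthonormalEigenbasis basis

  -- The kernel of the permuted basis at `x` and `y` is by definition the kernel of `v` at `φ x` and
  -- `φ y`, so this is an instance of independence of the basis.
  kernel-invariant : ∀ φ → Invariant M φ → ∀ {k} {v : Fin k → Vector ℝ n} →
                     IsOrthonormalEigenbasis M μ v → Invariant (kernel v) φ
  kernel-invariant φ inv basis x y = kernel-unique (eigenbasis-∘ φ inv basis) basis x y

-- Graphs

module _ {n : ℕ} (G : SimpleGraph n) where

  private
    A : Matrix n
    A = adjacencyMatrix G

  adjacency-symmetric : ∀ x y → A x y ≡ A y x
  adjacency-symmetric x y = cong (if_then 1ℝ else 0ℝ)
    (does-⇔ (mk⇔ (symmetric G) (symmetric G)) (adj? G x y) (adj? G y x))

  degree-as-sum : ∀ x → degree G x ≡ ℕ∑.sum (λ y → if does (adj? G x y) then 1 else 0)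
  degree-as-sum x = length-filter-tabulate (adj? G x) id

  ∑-adjacency : ∀ x → ∑[ y < n ] A x y ≈ fromℕ (degree G x)
  ∑-adjacency x = begin
    ∑[ y < n ] A x y                                               ≈⟨ sum-cong-≋ (λ y → entry (does (adj? G x y))) ⟨
    ∑[ y < n ] fromℕ (if does (adj? G x y) then 1 else 0)          ≈⟨ fromℕ-∑ (λ y → if does (adj? G x y) then 1 else 0) ⟨
    fromℕ (ℕ∑.sum (λ y → if does (adj? G x y) then 1 else 0))      ≡⟨ cong fromℕ (degree-as-sum x) ⟨
    fromℕ (degree G x)                                             ∎
    where
    entry : ∀ b → fromℕ (if b then 1 else 0) ≈ (if b then 1ℝ else 0ℝ)
    entry true  = pointwise _ _ λ _ → refl
    entry false = pointwise _ _ λ _ → refl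

  -- Pairs that are not adjacent contribute nothing, and the sum of the degrees counts the ordered
  -- adjacent pairs.
  ∑-adjacency-cong : ∀ {f : Matrix n} {c} → (∀ {x y} → Adj G x y → f x y ≈ c) →
    ∑[ x < n ] ∑[ y < n ] (A x y * f x y) ≈ fromℕ (ℕ∑.sum (degree G)) * c
  ∑-adjacency-cong {f} {c} f≈c = begin
    ∑[ x < n ] ∑[ y < n ] (A x y * f x y)    ≈⟨ sum-cong-≋ (λ x → sum-cong-≋ (λ y → constant x y)) ⟩
    ∑[ x < n ] ∑[ y < n ] (A x y * c)        ≈⟨ sum-cong-≋ (λ x → *-distribʳ-sum c (A x)) ⟨
    ∑[ x < n ] (∑[ y < n ] A x y * c)        ≈⟨ sum-cong-≋ (λ x → R.*-congʳ (∑-adjacency x)) ⟩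
    ∑[ x < n ] (fromℕ (degree G x) * c)      ≈⟨ *-distribʳ-sum c (fromℕ ∘ degree G) ⟨
    ∑[ x < n ] fromℕ (degree G x) * c        ≈⟨ R.*-congʳ (fromℕ-∑ (degree G)) ⟨
    fromℕ (ℕ∑.sum (degree G)) * c            ∎
    where
    constant : ∀ x y → A x y * f x y ≈ A x y * c
    constant x y with adj? G x y
    ... | yes x~y = R.*-congˡ (f≈c x~y)
    ... | no  _   = R.trans (R.zeroˡ (f x y)) (R.sym (R.zeroˡ c))

  module _ (φ : Permutation′ n) (automorphism : IsAutomorphism G φ) where

    does-adj?-invariant : ∀ x y → does (adj? G (φ ⟨$⟩ʳ x) (φ ⟨$⟩ʳ y)) ≡ does (adj? G x y)
    does-adj?-invariant x y =
      ≡.sym (does-⇔ (automorphism x y) (adj? G x y) (adj? G (φ ⟨$⟩ʳ x) (φ ⟨$⟩ʳ y)))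

    adjacency-invariant : ∀ x y → A (φ ⟨$⟩ʳ x) (φ ⟨$⟩ʳ y) ≡ A x y
    adjacency-invariant x y = cong (if_then 1ℝ else 0ℝ) (does-adj?-invariant x y)

    -- The sum counting the neighbours of `φ x` is reindexed along `φ`, after which each term is the
    -- adjacency of `x` and `y`.
    degree-invariant : ∀ x → degree G (φ ⟨$⟩ʳ x) ≡ degree G x
    degree-invariant x = ≡.trans (degree-as-sum (φ ⟨$⟩ʳ x))
      (≡.trans (ℕ∑.∑-permute (λ y → if does (adj? G (φ ⟨$⟩ʳ x) y) then 1 else 0) φ)
      (≡.trans (ℕ∑.sum-cong-≗ (λ y → cong (if_then 1 else 0) (does-adj?-invariant x y)))
               (≡.sym (degree-as-sum x))))

-- The normalized Laplacian and its eigenvectors.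

identity-invariant : ∀ {n} (φ : Permutation′ n) → Invariant (identity n) φ
identity-invariant φ x y = R.reflexive (cong (if_then 1ℝ else 0ℝ)
  (does-⇔ (mk⇔ (Injection.injective (↔⇒↣ φ)) (cong (φ ⟨$⟩ʳ_))) (φ ⟨$⟩ʳ x Fin.≟ φ ⟨$⟩ʳ y) (x Fin.≟ y)))

module _ {n : ℕ} (G : SimpleGraph n) (2≤n : 2 ≤ n) (connected : Connected G) where

  open NormalizedLaplacian G 2≤n connected

  private
    A : Matrix n
    A = adjacencyMatrix G

    d : Fin n → ℕ
    d = degree G

    instance
      d≢0 : ∀ {x} → ℕ.NonZero (d x)
      d≢0 {x} = degree-nonZero G 2≤n connected x

    s : Fin n → ℝ
    s x = 1/√ (d x)

  𝓛-entry : ∀ x y → 𝓛 x y ≈ identity n x y - s x * A x y * s y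
  𝓛-entry x y = R.+-congˡ (neg-cong (begin
    ∑[ l < n ] ((D^-½ ⊗ A) x l * D^-½ l y)   ≈⟨ ∑-diagonalʳ s ((D^-½ ⊗ A) x) y ⟩
    (D^-½ ⊗ A) x y * s y                     ≈⟨ R.*-congʳ (∑-diagonalˡ s (λ l → A l y) x) ⟩
    s x * A x y * s y                        ∎))

  private
    -- The number of ordered pairs of adjacent vertices, that is, twice the number of edges.
    m : ℕ
    m = ℕ∑.sum d

  module _ (φ : Permutation′ n) (automorphism : IsAutomorphism G φ) where

    s-invariant : ∀ x → s (φ ⟨$⟩ʳ x) ≡ s x
    s-invariant x = 1/√-cong (degree-invariant G φ automorphism x)

    𝓛-invariant : Invariant 𝓛 φ
    𝓛-invariant x y = begin
      𝓛 φx φy                                        ≈⟨ 𝓛-entry φx φy ⟩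
      identity n φx φy - s φx * A φx φy * s φy       ≈⟨ R.+-cong (identity-invariant φ x y) (R.reflexive (cong -_
                                                          (cong₂ _*_ (cong₂ _*_ (s-invariant x) (adjacency-invariant G φ automorphism x y))
                                                                     (s-invariant y)))) ⟩
      identity n x y - s x * A x y * s y             ≈⟨ 𝓛-entry x y ⟨
      𝓛 x y                                          ∎
      where
      φx = φ ⟨$⟩ʳ x
      φy = φ ⟨$⟩ʳ y

  𝓛-· : ∀ v x → (𝓛 · v) x ≈ v x - s x * ∑[ y < n ] (A x y * (s y * v y))
  𝓛-· v x = begin
    ∑[ y < n ] (𝓛 x y * v y)                                                ≈⟨ sum-cong-≋ term ⟩
    ∑[ y < n ] (identity n x y * v y - s x * (A x y * (s y * v y)))         ≈⟨ ∑-distrib-- (λ y → identity n x y * v y) (λ y → s x * (A x y * (s y * v y))) ⟩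
    ∑[ y < n ] (identity n x y * v y) - ∑[ y < n ] (s x * (A x y * (s y * v y)))
      ≈⟨ R.+-cong (R.trans (∑-diagonalˡ (λ _ → 1ℝ) v x) (R.*-identityˡ (v x)))
                  (neg-cong (R.sym (*-distribˡ-sum (s x) (λ y → A x y * (s y * v y))))) ⟩
    v x - s x * ∑[ y < n ] (A x y * (s y * v y))                            ∎
    where
    term : ∀ y → 𝓛 x y * v y ≈ identity n x y * v y - s x * (A x y * (s y * v y))
    term y = begin
      𝓛 x y * v y                                                ≈⟨ R.*-congʳ (𝓛-entry x y) ⟩
      (identity n x y - s x * A x y * s y) * v y                 ≈⟨ [y-z]x≈yx-zx (v y) (identity n x y) (s x * A x y * s y) ⟩
      identity n x y * v y - s x * A x y * s y * v y             ≈⟨ R.+-congˡ (neg-cong (solve 4 (λ a b c e → a :* b :* c :* e := a :* (b :* (c :* e))) R.refl (s x) (A x y) (s y) (v y))) ⟩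
      identity n x y * v y - s x * (A x y * (s y * v y))         ∎

  -- The eigenvalue equation solved for its adjacency part: `v x - t` equals `μ * v x`, hence `t`
  -- equals `v x - μ * v x`.
  eigenvector-average : ∀ {μ v} → InEigenspace 𝓛 μ v →
    ∀ x → s x * ∑[ y < n ] (A x y * (s y * v y)) ≈ (1ℝ - μ) * v x
  eigenvector-average {μ} {v} v∈E x = begin
    t                             ≈⟨ R.+-identityˡ t ⟨
    0ℝ + t                        ≈⟨ R.+-congʳ (R.-‿inverseʳ (v x)) ⟨
    (v x - v x) + t               ≈⟨ solve 3 (λ a b c → (a :+ b) :+ c := a :+ (b :+ c)) R.refl (v x) (- v x) t ⟩
    v x + (- v x + t)             ≈⟨ R.+-congˡ (R.+-comm (- v x) t) ⟩
    v x + (t - v x)               ≈⟨ R.+-congˡ (⁻¹-anti-homo-// (v x) t) ⟨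
    v x - (v x - t)               ≈⟨ R.+-cong (R.sym (R.*-identityˡ (v x))) (neg-cong (R.trans (R.sym (𝓛-· v x)) (v∈E x))) ⟩
    1ℝ * v x - μ * v x            ≈⟨ [y-z]x≈yx-zx (v x) 1ℝ μ ⟨
    (1ℝ - μ) * v x                ∎
    where t = s x * ∑[ y < n ] (A x y * (s y * v y))

  -- The scaled kernel and its sums over adjacent pairs.

  scaledKernel : ∀ {k} → (Fin k → Vector ℝ n) → Matrix n
  scaledKernel v x y = s x * s y * kernel v x y

  module _ {k : ℕ} (v : Fin k → Vector ℝ n) where

    private
      K P : Matrix n
      K = scaledKernel v
      P = kernel v

    scaledKernel-symmetric : ∀ x y → K x y ≈ K y x
    scaledKernel-symmetric x y =
      *-cong (R.*-comm (s x) (s y)) (sum-cong-≋ (λ i → R.*-comm (v i x) (v i y)))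

    -- The summand is the same for all `d x` neighbours, and this count cancels the factor
    -- `s x * s x`, which is `1/ℕ (d x)`.
    ∑-adjacency-diagonal : ∀ x → ∑[ y < n ] (A x y * K x x) ≈ P x x
    ∑-adjacency-diagonal x = begin
      ∑[ y < n ] (A x y * K x x)               ≈⟨ *-distribʳ-sum (K x x) (A x) ⟨
      ∑[ y < n ] A x y * K x x                 ≈⟨ R.*-congʳ (∑-adjacency G x) ⟩
      fromℕ (d x) * (s x * s x * P x x)        ≈⟨ R.*-assoc (fromℕ (d x)) (s x * s x) (P x x) ⟨
      fromℕ (d x) * (s x * s x) * P x x        ≈⟨ R.*-congʳ (R.*-congˡ (1/√-square (d x))) ⟩
      fromℕ (d x) * 1/ℕ (d x) * P x x          ≈⟨ R.*-congʳ (1/ℕ-inverse (d x)) ⟩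
      1ℝ * P x x                               ≈⟨ R.*-identityˡ (P x x) ⟩
      P x x                                    ∎

    -- Exchanging the sums and using the symmetry of `A` turns the part with `K y y` into the part
    -- with `K x x`; each contributes the trace of `P`.
    ∑∑-adjacency-diagonal : ∑[ x < n ] ∑[ y < n ] (A x y * (K x x + K y y)) ≈ fromℕ 2 * ∑[ x < n ] P x x
    ∑∑-adjacency-diagonal = begin
      ∑[ x < n ] ∑[ y < n ] (A x y * (K x x + K y y))
        ≈⟨ sum-cong-≋ (λ x → sum-cong-≋ (λ y → R.distribˡ (A x y) (K x x) (K y y))) ⟩
      ∑[ x < n ] ∑[ y < n ] (A x y * K x x + A x y * K y y)
        ≈⟨ sum-cong-≋ (λ x → ∑-distrib-+ (λ y → A x y * K x x) (λ y → A x y * K y y)) ⟩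
      ∑[ x < n ] (∑[ y < n ] (A x y * K x x) + ∑[ y < n ] (A x y * K y y))
        ≈⟨ ∑-distrib-+ (λ x → ∑[ y < n ] (A x y * K x x)) (λ x → ∑[ y < n ] (A x y * K y y)) ⟩
      ∑[ x < n ] ∑[ y < n ] (A x y * K x x) + ∑[ x < n ] ∑[ y < n ] (A x y * K y y)
        ≈⟨ R.+-congˡ (∑-comm (λ x y → A x y * K y y)) ⟩
      ∑[ x < n ] ∑[ y < n ] (A x y * K x x) + ∑[ y < n ] ∑[ x < n ] (A x y * K y y)
        ≈⟨ R.+-congˡ (sum-cong-≋ (λ y → sum-cong-≋ (λ x → R.*-congʳ {K y y} (R.reflexive (adjacency-symmetric G x y))))) ⟩
      ∑[ x < n ] ∑[ y < n ] (A x y * K x x) + ∑[ y < n ] ∑[ x < n ] (A y x * K y y)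
        ≈⟨ R.+-cong (sum-cong-≋ ∑-adjacency-diagonal) (sum-cong-≋ ∑-adjacency-diagonal) ⟩
      t + t
        ≈⟨ R.+-cong (R.*-identityˡ t) (R.*-identityˡ t) ⟨
      1ℝ * t + 1ℝ * t
        ≈⟨ R.distribʳ t 1ℝ 1ℝ ⟨
      (1ℝ + 1ℝ) * t
        ≈⟨ R.*-congʳ (pointwise (1ℝ + 1ℝ) (fromℕ 2) λ _ → refl) ⟩
      fromℕ 2 * t ∎
      where t = ∑[ x < n ] P x x

    module _ {μ : ℝ} (v∈E : ∀ i → InEigenspace 𝓛 μ (v i)) where

      -- With the sum over `i` outermost, the sum over `y` is the adjacency part of the eigenvalue
      -- equation for `v i` at `x`, multiplied by `v i x`.
      ∑-adjacency-scaledKernel : ∀ x → ∑[ y < n ] (A x y * K x y) ≈ (1ℝ - μ) * P x x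
      ∑-adjacency-scaledKernel x = begin
        ∑[ y < n ] (A x y * (s x * s y * P x y))
          ≈⟨ sum-cong-≋ (λ y → term y) ⟩
        ∑[ y < n ] ∑[ i < k ] (v i x * s x * (A x y * (s y * v i y)))
          ≈⟨ ∑-comm (λ y i → v i x * s x * (A x y * (s y * v i y))) ⟩
        ∑[ i < k ] ∑[ y < n ] (v i x * s x * (A x y * (s y * v i y)))
          ≈⟨ sum-cong-≋ (λ i → *-distribˡ-sum (v i x * s x) (λ y → A x y * (s y * v i y))) ⟨
        ∑[ i < k ] (v i x * s x * ∑[ y < n ] (A x y * (s y * v i y)))
          ≈⟨ sum-cong-≋ (λ i → average i) ⟩
        ∑[ i < k ] ((1ℝ - μ) * (v i x * v i x))
          ≈⟨ *-distribˡ-sum (1ℝ - μ) (λ i → v i x * v i x) ⟨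
        (1ℝ - μ) * P x x ∎
        where
        term : ∀ y → A x y * (s x * s y * P x y) ≈ ∑[ i < k ] (v i x * s x * (A x y * (s y * v i y)))
        term y = begin
          A x y * (s x * s y * P x y)
            ≈⟨ R.*-assoc (A x y) (s x * s y) (P x y) ⟨
          A x y * (s x * s y) * P x y
            ≈⟨ *-distribˡ-sum (A x y * (s x * s y)) (λ i → v i x * v i y) ⟩
          ∑[ i < k ] (A x y * (s x * s y) * (v i x * v i y))
            ≈⟨ sum-cong-≋ (λ i → solve 5 (λ a p q f g → a :* (p :* q) :* (f :* g) := f :* p :* (a :* (q :* g)))
                 R.refl (A x y) (s x) (s y) (v i x) (v i y)) ⟩
          ∑[ i < k ] (v i x * s x * (A x y * (s y * v i y))) ∎
        average : ∀ i → v i x * s x * ∑[ y < n ] (A x y * (s y * v i y)) ≈ (1ℝ - μ) * (v i x * v i x)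
        average i = begin
          v i x * s x * σ                ≈⟨ R.*-assoc (v i x) (s x) σ ⟩
          v i x * (s x * σ)              ≈⟨ R.*-congˡ (eigenvector-average (v∈E i) x) ⟩
          v i x * ((1ℝ - μ) * v i x)     ≈⟨ solve 2 (λ f ν → f :* (ν :* f) := ν :* (f :* f)) R.refl (v i x) (1ℝ - μ) ⟩
          (1ℝ - μ) * (v i x * v i x)     ∎
          where σ = ∑[ y < n ] (A x y * (s y * v i y))

      ∑∑-adjacency-scaledKernel : ∑[ x < n ] ∑[ y < n ] (A x y * K x y) ≈ (1ℝ - μ) * ∑[ x < n ] P x x
      ∑∑-adjacency-scaledKernel = R.trans (sum-cong-≋ ∑-adjacency-scaledKernel)
        (R.sym (*-distribˡ-sum (1ℝ - μ) (λ x → P x x)))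

    -- The three degree factors are products of two values of `s`, so each sum over `i` is an entry
    -- of `K`.
    ∑-edgeDerivative-terms : ∀ ν x y .{{_ : ℕ.NonZero (d x ℕ.* d y)}} →
      ∑[ i < k ] (ν * (v i x * v i x * 1/ℕ (d x) + v i y * v i y * 1/ℕ (d y))
                    - fromℕ 2 * (v i x * v i y * 1/√ (d x ℕ.* d y)))
      ≈ ν * (K x x + K y y) - fromℕ 2 * K x y
    ∑-edgeDerivative-terms ν x y = R.trans
      (∑-distrib-- (λ i → ν * (v i x * v i x * 1/ℕ (d x) + v i y * v i y * 1/ℕ (d y)))
                   (λ i → fromℕ 2 * (v i x * v i y * 1/√ (d x ℕ.* d y))))
      (R.+-cong
        (R.trans (R.sym (*-distribˡ-sum ν (λ i → v i x * v i x * 1/ℕ (d x) + v i y * v i y * 1/ℕ (d y))))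
          (R.*-congˡ (R.trans (∑-distrib-+ (λ i → v i x * v i x * 1/ℕ (d x)) (λ i → v i y * v i y * 1/ℕ (d y)))
            (R.+-cong (scale x x (1/√-square (d x))) (scale y y (1/√-square (d y)))))))
        (neg-cong (R.trans (R.sym (*-distribˡ-sum (fromℕ 2) (λ i → v i x * v i y * 1/√ (d x ℕ.* d y))))
          (R.*-congˡ (scale x y (R.sym (1/√-* (d x) (d y))))))))
      where
      scale : ∀ x y {c} → s x * s y ≈ c → ∑[ i < k ] (v i x * v i y * c) ≈ K x y
      scale x y {c} sxsy≈c = begin
        ∑[ i < k ] (v i x * v i y * c)   ≈⟨ *-distribʳ-sum c (λ i → v i x * v i y) ⟨
        P x y * c                        ≈⟨ R.*-comm (P x y) c ⟩
        c * P x y                        ≈⟨ R.*-congʳ sxsy≈c ⟨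
        s x * s y * P x y                ∎

  -- Consequences of edge transitivity.

  module _ (edgeTransitive : EdgeTransitive G) {μ : ℝ} {k : ℕ} {v : Fin k → Vector ℝ n}
           (basis : IsOrthonormalEigenbasis 𝓛 μ v) where

    private
      K P : Matrix n
      K = scaledKernel v
      P = kernel v

    scaledKernel-invariant : ∀ φ → IsAutomorphism G φ → Invariant K φ
    scaledKernel-invariant φ automorphism x y = *-cong
      (R.reflexive (cong₂ _*_ (s-invariant φ automorphism x) (s-invariant φ automorphism y)))
      (kernel-invariant φ (𝓛-invariant φ automorphism) basis x y)

    -- An automorphism carries one edge to the other; if it reverses the endpoints, the symmetry of
    -- `K` repairs the order.
    scaledKernel-constant : ∀ {x y u w} → Adj G x y → Adj G u w → K u w ≈ K x y
    scaledKernel-constant {x} {y} x~y u~w with edgeTransitive x~y u~w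
    ... | φ , automorphism , inj₁ (refl , refl) = scaledKernel-invariant φ automorphism x y
    ... | φ , automorphism , inj₂ (refl , refl) = R.trans
      (scaledKernel-symmetric v (φ ⟨$⟩ʳ y) (φ ⟨$⟩ʳ x)) (scaledKernel-invariant φ automorphism x y)

    -- Only the sum over both endpoints is constant: the automorphism may exchange their roles, and
    -- in a star, for instance, the centre and a leaf can have different diagonal entries.
    diagonal-constant : ∀ {x y u w} → Adj G x y → Adj G u w → K u u + K w w ≈ K x x + K y y
    diagonal-constant {x} {y} x~y u~w with edgeTransitive x~y u~w
    ... | φ , automorphism , inj₁ (refl , refl) =
      R.+-cong (scaledKernel-invariant φ automorphism x x) (scaledKernel-invariant φ automorphism y y)
    ... | φ , automorphism , inj₂ (refl , refl) = R.trans
      (R.+-comm (K (φ ⟨$⟩ʳ y) (φ ⟨$⟩ʳ y)) (K (φ ⟨$⟩ʳ x) (φ ⟨$⟩ʳ x)))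
      (R.+-cong (scaledKernel-invariant φ automorphism x x) (scaledKernel-invariant φ automorphism y y))

    diagonal≈scaledKernel : ∀ {x y} → Adj G x y → (1ℝ - μ) * (K x x + K y y) ≈ fromℕ 2 * K x y
    diagonal≈scaledKernel {x} {y} x~y = begin
      (1ℝ - μ) * (K x x + K y y)
        -- The double sum is computed in two ways, as `m` times its constant value on edges and as a
        -- multiple of the trace `t`; dividing by `m` gives the value on the edge itself.
        ≈⟨ R.*-congˡ (fromℕ-cancel m (R.trans
             (R.sym (∑-adjacency-cong G (diagonal-constant x~y))) (∑∑-adjacency-diagonal v))) ⟩
      (1ℝ - μ) * (1/ℕ m * (fromℕ 2 * t))
        ≈⟨ solve 4 (λ ν p c t → ν :* (p :* (c :* t)) := c :* (p :* (ν :* t))) R.refl (1ℝ - μ) (1/ℕ m) (fromℕ 2) t ⟩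
      fromℕ 2 * (1/ℕ m * ((1ℝ - μ) * t))
        ≈⟨ R.*-congˡ (fromℕ-cancel m (R.trans
             (R.sym (∑-adjacency-cong G (scaledKernel-constant x~y)))
             (∑∑-adjacency-scaledKernel v (IsOrthonormalEigenbasis.inEigenspace basis)))) ⟨
      fromℕ 2 * K x y ∎
      where
      t = ∑[ x < n ] P x x
      instance
        m≢0 : ℕ.NonZero m
        -- The endpoint `x` shows that there is a vertex, and every degree is positive by
        -- connectedness.
        m≢0 = ℕ∑-nonZero d x (λ _ → d≢0)

theorem2p14 : ∀ {n : ℕ} (G : SimpleGraph n) (2≤n : 2 ≤ n) (connected : Connected G) →
    EdgeTransitive G →
    let open NormalizedLaplacian G 2≤n connected in
    (μ : ℝ) (eigenvalue : IsEigenvalue 𝓛 μ) →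
    ∀ {k : ℕ} (v : Fin k → Vector ℝ n) (basis : IsOrthonormalEigenbasis 𝓛 μ v) →
    ∀ {x y : Fin n} → Adj G x y →
    edgeDerivative μ eigenvalue v basis x y ≈ 0ℝ
theorem2p14 G 2≤n connected edgeTransitive μ eigenvalue {k} v basis {x} {y} x~y = begin
  edgeDerivative μ eigenvalue v basis x y
    ≈⟨ R.*-congˡ (∑-edgeDerivative-terms G 2≤n connected v (1ℝ - μ) x y) ⟩
  1/ℕ k * ((1ℝ - μ) * (K x x + K y y) - fromℕ 2 * K x y)
    ≈⟨ R.*-congˡ (x≈y⇒x∙y⁻¹≈ε (diagonal≈scaledKernel G 2≤n connected edgeTransitive basis x~y)) ⟩
  1/ℕ k * 0ℝ
    ≈⟨ R.zeroʳ (1/ℕ k) ⟩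
  0ℝ ∎
  where
  open NormalizedLaplacian G 2≤n connected
  K = scaledKernel G 2≤n connected v
  -- Proofs of `NonZero` are irrelevant, so these agree with the ones used inside `edgeDerivative`.
  instance
    k≢0 : ℕ.NonZero k
    k≢0 = multiplicity-nonZero eigenvalue basis
    dxdy≢0 : ℕ.NonZero (degree G x ℕ.* degree G y)
    dxdy≢0 = ℕ.m*n≢0 (degree G x) (degree G y)
      {{degree-nonZero G 2≤n connected x}} {{degree-nonZero G 2≤n connected y}}
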